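{- The minimum order of a barnacle-free Harris graph is $13$: there exists a barnacle-free Harris graph on $13$ vertices, and every barnacle-free Harris graph has at least $13$ vertices.
   Context: All graphs are finite, simple and undirected. A graph $G$ is tough if it is connected and for every nonempty set $S$ of vertices, the number of connected components of $G-S$ is at most $|S|$. A graph is Eulerian if it is connected and every vertex has even degree. A graph is Hamiltonian if it contains a spanning cycle. A Harris graph is a graph that is tough, Eulerian, and not Hamiltonian. For $k\ge 2$, a $k$-barnacle in a graph is a path of length $k$ between two distinct vertices $x$ and $y$ all of whose internal vertices have degree $2$ in the graph. A graph is barnacle-free if it contains no $k$-barnacle for any $k\ge 2$, equivalently if it has no vertex of degree $2$.
   Formalization: The one-vertex graph is counted as Hamiltonian; otherwise it would be tough, Eulerian, without a spanning cycle and without a vertex of degree 2, hence a barnacle-free Harris graph of order 1, contradicting the claim. -}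

module Defs where

open import Data.Bool using (Bool; true; false)
open import Data.Nat using (ℕ; _≤_)
open import Data.Nat.Divisibility using (_∣_)
open import Data.Fin using (Fin)
open import Data.Fin.Subset using (Subset; _∉_; ∣_∣; Nonempty)
open import Data.List using (List; []; _∷_; _++_; [_]; length; filterᵇ; allFin)
open import Data.List.Relation.Unary.All using (All)
open import Data.List.Relation.Unary.AllPairs using (AllPairs)
open import Data.List.Relation.Unary.Linked using (Linked)
open import Data.Product using (Σ; _×_; ∃)
open import Data.Sum using (_⊎_)
open import Relation.Binary.PropositionalEquality using (_≡_; _≢_)
open import Relation.Nullary using (¬_)

record Graph (n : ℕ) : Set where
  field
    adj    : Fin n → Fin n → Bool
    sym    : ∀ u v → adj u v ≡ adj v u
    irrefl : ∀ u → adj u u ≡ false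
open Graph public

module _ {n : ℕ} (G : Graph n) where

  Adj : Fin n → Fin n → Set
  Adj u v = adj G u v ≡ true

  degree : Fin n → ℕ
  degree u = length (filterᵇ (adj G u) (allFin n))

  data WalkAvoiding (S : Subset n) : Fin n → Fin n → Set where
    here : ∀ {u} → u ∉ S → WalkAvoiding S u u
    step : ∀ {u w v} → u ∉ S → Adj u w → WalkAvoiding S w v → WalkAvoiding S u v

  data Walk : Fin n → Fin n → Set where
    here : ∀ {u} → Walk u u
    step : ∀ {u w v} → Adj u w → Walk w v → Walk u v

  Connected : Set
  Connected = Fin n × (∀ u v → Walk u v)

  -- "G - S has at most |S| components": every family of vertices of G - S
  -- lying in pairwise distinct components of G - S has at most |S| members
  -- (the number of components is the maximum size of such a family).
  ComponentsAtMost : Subset n → ℕ → Set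
  ComponentsAtMost S k =
    ∀ (xs : List (Fin n)) → All (_∉ S) xs →
    AllPairs (λ u v → ¬ WalkAvoiding S u v) xs → length xs ≤ k

  Tough : Set
  Tough = Connected × (∀ (S : Subset n) → Nonempty S → ComponentsAtMost S ∣ S ∣)

  Eulerian : Set
  Eulerian = Connected × (∀ u → 2 ∣ degree u)

  SpanningCycle : Set
  SpanningCycle = Σ (Fin n) λ x → Σ (List (Fin n)) λ xs →
    (3 ≤ n) × (length (x ∷ xs) ≡ n) × AllPairs _≢_ (x ∷ xs) ×
    Linked Adj (x ∷ xs ++ [ x ])

  -- Hamiltonian; by the standard convention the one-vertex graph K₁ counts
  -- as Hamiltonian (otherwise K₁ would be a barnacle-free Harris graph).
  Hamiltonian : Set
  Hamiltonian = (n ≡ 1) ⊎ SpanningCycle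

  Harris : Set
  Harris = Tough × Eulerian × ¬ Hamiltonian

  -- barnacle-free: no vertex of degree 2 (equivalent to having no k-barnacle)
  BarnacleFree : Set
  BarnacleFree = ∀ u → ¬ (degree u ≡ 2)

{-# OPTIONS --safe #-}
module Submission where

-- Lower bound. In a barnacle-free Harris graph all degrees are at least 4, and this, toughness and
-- the absence of a spanning cycle already contradict n ≤ 12. A pattern, i.e. a set of edges on the
-- labels 0, …, n − 1, is refuted if no labelling of the vertices turns all of it into edges of the
-- graph. The cycle on all n vertices is refuted by assumption. From it one refutes the shorter
-- cycles down to length 8 (for n ≥ 9), then the paths on n, n − 1, …, 1 vertices; the path on one
-- vertex is the empty pattern. Each step is a finite case analysis on which pairs are adjacent: a
-- branch closes when a refuted pattern appears under some relabelling, when a vertex is left with at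
-- most three possible neighbours, or when a set of k vertices is left separating the others into
-- k + 1 parts. A pair is nonadjacent as soon as joining it would create a longer cycle or path than
-- allowed, so few cases remain, and they are recorded in certificates checked by evaluation.

open import Defs
open import Data.Bool using (Bool; true; false; T; not; _∧_; _∨_; if_then_else_)
import Data.Bool.Properties as Bool
open import Data.Bool.ListAction using (all; any)
open import Data.Bool.Properties using (T-∧; T-∨; T-≡)
open import Data.Empty using (⊥)
open import Data.Fin using (Fin; zero; suc; toℕ; fromℕ<; #_)
open import Data.Fin.Properties using (all?; toℕ<n; fromℕ<-toℕ; toℕ-fromℕ<; toℕ-injective) renaming (_≟_ to _≟ᶠ_)
import Data.Fin.Subset as Subset
open import Data.Fin.Subset using (Subset; inside; outside; _∉_; ∣_∣; Nonempty) renaming (⊥ to ∅)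
open import Data.Fin.Subset.Properties using (∉⊥; x∈p⇒∣p-x∣<∣p∣)
import Data.List as List
open import Data.List using (List; []; _∷_; _++_; [_]; length; map; filterᵇ; allFin; foldr; upTo; applyUpTo; replicate)
open import Data.List.Membership.DecPropositional using () renaming (_∈?_ to member?)
open import Data.List.Membership.Propositional using (_∈_)
open import Data.List.Membership.Propositional.Properties using (∈-∃++; ∈-++⁻; ∈-++⁺ˡ; ∈-++⁺ʳ; ∈-allFin; ∈-map⁻; ∈-filter⁺; ∈-filter⁻; ∈-length; ∈-upTo⁺)
open import Data.List.Properties using (++-assoc; length-++; length-applyUpTo; length-filter; length-map; length-tabulate)
import Data.List.Relation.Binary.Permutation.Setoid.Properties as Permutation
open import Data.List.Relation.Binary.Subset.Propositional using (_⊆_)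
open import Data.List.Relation.Unary.All as All using (All; []; _∷_)
import Data.List.Relation.Unary.All.Properties as All
open import Data.List.Relation.Unary.AllPairs using (AllPairs; []; _∷_)
import Data.List.Relation.Unary.AllPairs.Properties as AllPairs
open import Data.List.Relation.Unary.Any as Any using (here; there)
open import Data.List.Relation.Unary.Any.Properties using (any⁻; any⁺; applyUpTo⁻)
open import Data.List.Relation.Unary.Linked using (Linked; [-]; _∷_)
open import Data.List.Relation.Unary.Unique.Propositional using (Unique)
import Data.List.Relation.Unary.Unique.Propositional.Properties as Unique
open import Data.Nat using (ℕ; zero; suc; pred; _+_; _∸_; _≤_; _<_; z≤n; s≤s; _≡ᵇ_; _<ᵇ_; _≤ᵇ_; _≟_; _≤?_; _<?_)
open import Data.Nat.Divisibility using (_∣_; divides; _∣?_)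
open import Data.Nat.DivMod using (_/_; _%_)
open import Data.Nat.Properties using (≡ᵇ⇒≡; <ᵇ⇒<; ≤ᵇ⇒≤; suc-injective; +-suc; +-comm; +-identityʳ; <-cmp; <-irrefl; <-trans; n≮n; n≤1+n; <⇒≢; <⇒≱; ≰⇒>; ≤-trans; ≤-antisym; ≤-reflexive; m≤n⇒m<n∨m≡n; module ≤-Reasoning)
open import Data.Product using (Σ; _×_; _,_; proj₁; proj₂; ∃)
open import Data.Sum using (_⊎_; inj₁; inj₂)
open import Data.Unit using (⊤)
open import Data.Vec using (lookup; tabulate; []; _∷_)
open import Data.Vec.Properties using (lookup∘tabulate; lookup⇒[]=; []=⇒lookup)
open import Function using (_∘_; id)
open import Function.Bundles using (Equivalence)
open import Relation.Binary.Definitions using (tri<; tri≈; tri>)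
open import Relation.Binary.PropositionalEquality using (_≡_; _≢_; refl; trans; cong; subst; subst₂; setoid) renaming (sym to ≡-sym)
open import Relation.Nullary using (¬_; ¬?; yes; no; contradiction)
open import Relation.Nullary.Decidable using (from-yes)

-- The bound 8 on cycles serves both halves of the argument. For n ≤ 12 at most four vertices lie
-- off a cycle of length at least 8, so with minimum degree 4 each of them has a neighbour on it; a
-- cycle stage therefore comes down to refuting the cycle with one pendant edge. Once these cycles
-- are gone, an end of a longest path has its four neighbours among the next six vertices of the
-- path, since a chord reaching further would close a cycle of length at least 8.
--
-- Refutation quantifies over all labellings, so a pattern refuted once is refuted in every
-- position; this replaces all arguments by symmetry.
--
-- The example on 13 vertices is verified directly. Nonhamiltonicity is an exhaustive search. For
-- toughness, components are not counted: for each of the 2^13 vertex sets a cheap upper bound on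
-- their number is computed from a fixed order of the vertices. Removing the vertices 0-3 leaves
-- exactly four components, so toughness is tight there, and what prevents a spanning cycle is a
-- count of edges.

private
  variable
    A : Set
    x y : Bool
    n : ℕ

-- Booleans and counting in lists

∧-proj : T (x ∧ y) → T x × T y
∧-proj = Equivalence.to T-∧

∨-case : T (x ∨ y) → T x ⊎ T y
∨-case = Equivalence.to T-∨

-- Pigeonhole: delete one occurrence of the head of `xs` from `ys`; uniqueness keeps the tail of
-- `xs` inside what remains.
length-mono-⊆ : {xs ys : List A} → Unique xs → xs ⊆ ys → length xs ≤ length ys
length-mono-⊆ {xs = []} _ _ = z≤n
length-mono-⊆ {xs = x ∷ xs} (x≢ ∷ uniq) xs⊆ys with ∈-∃++ (xs⊆ys (here refl))
... | as , bs , refl = begin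
  suc (length xs)               ≤⟨ s≤s (length-mono-⊆ uniq rest) ⟩
  suc (length (as ++ bs))       ≡⟨ cong suc (length-++ as) ⟩
  suc (length as + length bs)   ≡⟨ ≡-sym (+-suc (length as) (length bs)) ⟩
  length as + suc (length bs)   ≡⟨ ≡-sym (length-++ as) ⟩
  length (as ++ x ∷ bs)         ∎
  where
  open ≤-Reasoning
  rest : xs ⊆ as ++ bs
  rest z∈xs with ∈-++⁻ as (xs⊆ys (there z∈xs))
  ... | inj₁ z∈as          = ∈-++⁺ˡ z∈as
  ... | inj₂ (here z≡x)    = contradiction (≡-sym z≡x) (All.lookup x≢ z∈xs)
  ... | inj₂ (there z∈bs)  = ∈-++⁺ʳ as z∈bs

all-upTo⇒ : ∀ n {p : ℕ → Bool} → T (all p (upTo n)) → ∀ {i} → i < n → T (p i)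
all-upTo⇒ n {p} = All.applyUpTo⁻ id n ∘ All.all⁺ p (upTo n)

-- The map `h` is arbitrary so that the induction can pass to `h ∘ Fin.suc`.
∣tabulate∣≡length-filterᵇ : ∀ {m} (p : A → Bool) (h : Fin m → A) →
  ∣ tabulate (p ∘ h) ∣ ≡ length (filterᵇ p (List.tabulate h))
∣tabulate∣≡length-filterᵇ {m = zero}  p h = refl
∣tabulate∣≡length-filterᵇ {m = suc m} p h with p (h Fin.zero) | ∣tabulate∣≡length-filterᵇ p (h ∘ Fin.suc)
... | true  | eq = cong suc eq
... | false | eq = eq

-- Labellings and patterns

-- Labels are naturals rather than elements of `Fin n` so that certificates can be evaluated with
-- natural number arithmetic. Hence `vertex` is total, and only its values below n are constrained.
record Labelling (n : ℕ) : Set where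
  field
    vertex       : ℕ → Fin n
    label        : Fin n → ℕ
    label<n      : ∀ v → label v < n
    vertex-label : ∀ v → vertex (label v) ≡ v
    label-vertex : ∀ {i} → i < n → label (vertex i) ≡ i

  label-injective : ∀ {u v} → label u ≡ label v → u ≡ v
  label-injective eq = trans (≡-sym (vertex-label _)) (trans (cong vertex eq) (vertex-label _))

  vertex-injective : ∀ {i j} → i < n → j < n → vertex i ≡ vertex j → i ≡ j
  vertex-injective i<n j<n eq = trans (≡-sym (label-vertex i<n)) (trans (cong label eq) (label-vertex j<n))

  -- Turns a count of labels, done by evaluation, into a bound on a degree or on the size of a cut.
  count-vertices-≤ : (p : Fin n → Bool) (q : ℕ → Bool) → (∀ v → T (p v) → T (q (label v))) →
    length (filterᵇ p (allFin n)) ≤ length (filterᵇ q (upTo n))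
  count-vertices-≤ p q p⇒q = begin
    length (filterᵇ p (allFin n))               ≡⟨ ≡-sym (length-map label (filterᵇ p (allFin n))) ⟩
    length (map label (filterᵇ p (allFin n)))   ≤⟨ length-mono-⊆ unique included ⟩
    length (filterᵇ q (upTo n))                 ∎
    where
    open ≤-Reasoning
    unique : Unique (map label (filterᵇ p (allFin n)))
    unique = Unique.map⁺ label-injective (Unique.filter⁺ _ (Unique.allFin⁺ n))
    included : map label (filterᵇ p (allFin n)) ⊆ filterᵇ q (upTo n)
    included i∈ with ∈-map⁻ label i∈
    ... | v , v∈ , refl = ∈-filter⁺ _ (∈-upTo⁺ (label<n v)) (p⇒q v (proj₂ (∈-filter⁻ _ {xs = allFin n} v∈)))

open Labelling

-- The vertex `v₀` only fills the values of `vertex` out of range.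
identity : Fin n → Labelling n
identity {n} v₀ = record
  { vertex       = vert
  ; label        = toℕ
  ; label<n      = toℕ<n
  ; vertex-label = vert-toℕ
  ; label-vertex = toℕ-vert
  }
  where
  vert : ℕ → Fin n
  vert i with i <? n
  ... | yes i<n = fromℕ< i<n
  ... | no _    = v₀
  vert-toℕ : ∀ v → vert (toℕ v) ≡ v
  vert-toℕ v with toℕ v <? n
  ... | yes v<n = fromℕ<-toℕ v v<n
  ... | no v≮n  = contradiction (toℕ<n v) v≮n
  toℕ-vert : ∀ {i} → i < n → toℕ (vert i) ≡ i
  toℕ-vert {i} i<n with i <? n
  ... | yes i<n′ = toℕ-fromℕ< i<n′
  ... | no i≮n   = contradiction i<n i≮n

lookupOr : A → List A → ℕ → A
lookupOr d []       _       = d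
lookupOr d (x ∷ _)  zero    = x
lookupOr d (_ ∷ xs) (suc k) = lookupOr d xs k

nth : List ℕ → ℕ → ℕ
nth = lookupOr 0

-- An absent entry yields the length of the list, so `isPermutation` and `used` look the result up
-- again with `nth`.
index : List ℕ → ℕ → ℕ
index []       _ = 0
index (x ∷ xs) j = if x ≡ᵇ j then 0 else suc (index xs j)

isPermutation : ℕ → List ℕ → Bool
isPermutation n π = all entry (upTo n)
  where
  entry : ℕ → Bool
  entry j = (nth π j <ᵇ n) ∧ (index π j <ᵇ n) ∧ (nth π (index π j) ≡ᵇ j) ∧ (index π (nth π j) ≡ᵇ j)

-- Labels of a pattern are sent by `π` to labels of the current configuration, so `vertex` is
-- composed with `nth π` and `label` with its inverse `index π`.
relabel : Labelling n → ∀ π → T (isPermutation n π) → Labelling n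
relabel {n} L π perm = record
  { vertex       = vertex L ∘ nth π
  ; label        = index π ∘ label L
  ; label<n      = λ v → <ᵇ⇒< _ _ (proj₁ (proj₂ (entry (label<n L v))))
  ; vertex-label = λ v → trans (cong (vertex L) (≡ᵇ⇒≡ _ _ (proj₁ (proj₂ (proj₂ (entry (label<n L v)))))))
                               (vertex-label L v)
  ; label-vertex = λ i<n → trans (cong (index π) (label-vertex L (<ᵇ⇒< _ _ (proj₁ (entry i<n)))))
                                 (≡ᵇ⇒≡ _ _ (proj₂ (proj₂ (proj₂ (entry i<n)))))
  }
  where
  entry : ∀ {j} → j < n → T (nth π j <ᵇ n) × T (index π j <ᵇ n) × T (nth π (index π j) ≡ᵇ j) × T (index π (nth π j) ≡ᵇ j)
  entry {j} j<n =
    let a , rest  = ∧-proj {nth π j <ᵇ n} (all-upTo⇒ n perm j<n)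
        b , rest′ = ∧-proj {index π j <ᵇ n} rest
        c , d     = ∧-proj {nth π (index π j) ≡ᵇ j} rest′
    in a , b , c , d

Edge : Set
Edge = ℕ × ℕ

occurs : ℕ → ℕ → List Edge → Bool
occurs i j = any λ (a , b) → (a ≡ᵇ i) ∧ (b ≡ᵇ j) ∨ (a ≡ᵇ j) ∧ (b ≡ᵇ i)

pathEdges : ℕ → List Edge
pathEdges k = applyUpTo (λ i → i , suc i) (pred k)

cycleEdges : ℕ → List Edge
cycleEdges k = (pred k , 0) ∷ pathEdges k

-- Cycles and longer paths are looked for by depth-first search; whatever it returns is
-- validated by `matches`, so nothing is proved about the search itself.

neighbours : List Edge → ℕ → List ℕ
neighbours es v = foldr (λ (a , b) us → if a ≡ᵇ v then b ∷ us else if b ≡ᵇ v then a ∷ us else us) [] es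

member : ℕ → List ℕ → Bool
member v = any (_≡ᵇ v)

module Search (es : List Edge) (success : ℕ → List ℕ → Bool) (failure : ℕ → Bool) where

  orElse : List ℕ → List ℕ → List ℕ
  orElse []         ys = ys
  orElse xs@(_ ∷ _) _  = xs

  search : ℕ → ℕ → List ℕ → List ℕ
  search zero       v visited = []
  search (suc fuel) v visited =
    if success v visited then visited else
    if failure v then [] else
    foldr (λ u rest → if member u visited then rest else orElse (search fuel u (u ∷ visited)) rest)
          [] (neighbours es v)

-- Looks for a path from `i` to `j` on at least `bound` vertices, which the edge `i j` would close
-- to a cycle. A path that reaches `j` too early is abandoned by the failure test.
findCycle : ℕ → List Edge → ℕ → ℕ → ℕ → List ℕ
findCycle n es bound i j =
  Search.search es (λ v visited → (v ≡ᵇ j) ∧ (bound ≤ᵇ length visited)) (_≡ᵇ j) n i [ i ]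

-- The hypothetical edge `i j` is the first edge of the path, which is then prolonged from `j`. This
-- is why `blocked` tries both orientations.
findPath : ℕ → List Edge → ℕ → ℕ → ℕ → List ℕ
findPath n es k i j =
  Search.search es (λ _ visited → length visited ≡ᵇ k) (λ _ → false) n j (j ∷ i ∷ [])

-- The labels missed by the search are appended, because `relabel` needs a permutation of all
-- labels.
complete : ℕ → List ℕ → List ℕ
complete n π = π ++ filterᵇ (λ i → not (member i π)) (upTo n)

-- Certificates

-- The hexadecimal digits after a leading 1: 0x10a stands for 0 ∷ 10 ∷ [].
word : ℕ → List ℕ
word m = go 64 m []
  where
  go : ℕ → ℕ → List ℕ → List ℕ
  go zero       m ds = ds
  go (suc fuel) m ds = if m <ᵇ 16 then ds else go fuel (m / 16) (m % 16 ∷ ds)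

edges : ℕ → List Edge
edges m = pairs (word m)
  where
  pairs : List ℕ → List Edge
  pairs (i ∷ j ∷ ds) = (i , j) ∷ pairs ds
  pairs _            = []

-- `branch i j c d` refutes the pair i, j being adjacent by c and being nonadjacent by d. In `cut χ`
-- the digits of χ colour the labels: 0 for the vertices removed, 1, …, k + 1 for the parts.
-- `lemma k π` finds the k-th known pattern relabelled by π.
data Cert : Set where
  branch : ℕ → ℕ → Cert → Cert → Cert
  lowDegree cut : ℕ → Cert
  lemma : ℕ → ℕ → Cert

-- The patterns refuted so far: cycles of length at least `cycleBound`, paths on more than
-- `pathBound` vertices, and the listed ones, most recent first.
record Known : Set where
  constructor known
  field
    cycleBound pathBound : ℕ
    lemmas               : List (List Edge)

module Checker (n : ℕ) (K : Known) where
  open Known K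

  matches : List ℕ → List Edge → List Edge → Bool
  matches π P es = isPermutation n π ∧ all (λ (i , j) → occurs (nth π i) (nth π j) es) P

  longCycle : List Edge → List ℕ → Bool
  longCycle es c = (cycleBound ≤ᵇ length c) ∧ (length c ≤ᵇ n) ∧ matches (complete n c) (cycleEdges (length c)) es

  longPath : List Edge → List ℕ → Bool
  longPath es p = matches (complete n p) (pathEdges (suc pathBound)) es

  blocked : List Edge → ℕ → ℕ → Bool
  blocked es i j = longCycle es′ (findCycle n es cycleBound i j) ∨
    -- During the cycle stages, and for the path on all n vertices, `pathBound` is n and the path
    -- test is switched off.
    (pathBound <ᵇ n) ∧ (longPath es′ (findPath n es (suc pathBound) i j) ∨ longPath es′ (findPath n es (suc pathBound) j i))
    where
    es′ : List Edge
    es′ = (i , j) ∷ es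

  module _ (present absent : List Edge) where

    excluded : ℕ → ℕ → Bool
    excluded i j = occurs i j absent ∨ blocked present i j

    mayBeAdjacent : ℕ → ℕ → Bool
    mayBeAdjacent v u = occurs v u present ∨ not ((v ≡ᵇ u) ∨ excluded v u)

    degreeConflict : ℕ → Bool
    degreeConflict v = (v <ᵇ n) ∧ (length (filterᵇ (mayBeAdjacent v) (upTo n)) ≤ᵇ 3)

    module _ (colour : List ℕ) where

      removed : ℕ → Bool
      removed i = nth colour i ≡ᵇ 0

      -- A colour class may fall apart further; it is enough that no edge can join two classes,
      -- since each class is then a union of components.
      separated : ℕ → ℕ → Bool
      separated i j = removed i ∨ removed j ∨ (nth colour i ≡ᵇ nth colour j) ∨ excluded i j

      cutSize : ℕ
      cutSize = length (filterᵇ removed (upTo n))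

      used : ℕ → Bool
      used c = (index colour (suc c) <ᵇ n) ∧ (nth colour (index colour (suc c)) ≡ᵇ suc c)

      cutConflict : Bool
      cutConflict = any removed (upTo n) ∧ all used (upTo (suc cutSize)) ∧
        all (λ i → all (separated i) (upTo i)) (upTo n)

  check : Cert → List Edge → List Edge → Bool
  check (branch i j c d) present absent =
    check c ((i , j) ∷ present) absent ∧ check d present ((i , j) ∷ absent)
  check (lowDegree v) present absent = degreeConflict present absent v
  check (cut χ)    present absent = cutConflict present absent (word χ)
  -- The default pattern is a loop, which no graph contains.
  check (lemma k π) present _     = matches (word π) (lookupOr ((0 , 0) ∷ []) lemmas k) present

-- A lemma is an edge list in hexadecimal with its certificate, which may cite the lemmas listed
-- before it.
record Stage : Set where
  constructor stage
  field
    lemmas : List (ℕ × Cert)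
    main   : Cert

checkLemmas : ℕ → ℕ → ℕ → List Edge → List (List Edge) → List (ℕ × Cert) → Cert → Bool
checkLemmas n b p base known′ []               main = Checker.check n (known b p known′) main base []
checkLemmas n b p base known′ ((P , c) ∷ rest) main =
  Checker.check n (known b p known′) c (edges P) [] ∧ checkLemmas n b p base (edges P ∷ known′) rest main

checkStage : ℕ → ℕ → ℕ → List Edge → Stage → Bool
checkStage n b p base (stage lemmas main) = checkLemmas n b p base [] lemmas main

-- The stages refute the cycles of length n − 1, n − 2, …
checkCycles : ℕ → ℕ → List Stage → Bool
checkCycles n (suc c) (s ∷ ss) = checkStage n (suc c) n (cycleEdges c) s ∧ checkCycles n c ss
checkCycles n zero    (s ∷ ss) = false
checkCycles n c       []       = true

-- The stages refute the paths on n, n − 1, …, 1 vertices.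
checkPaths : ℕ → ℕ → ℕ → List Stage → Bool
-- The value 0 says that every path on more than 0 vertices is refuted.
checkPaths n b p       []       = p ≡ᵇ 0
checkPaths n b zero    (s ∷ ss) = false
checkPaths n b (suc p) (s ∷ ss) = checkStage n b (suc p) (pathEdges (suc p)) s ∧ checkPaths n b p ss

record Refutation : Set where
  constructor refutation
  field
    cycles paths : List Stage

checkRefutation : ℕ → Refutation → Bool
checkRefutation n (refutation cycles paths) =
  checkCycles n n cycles ∧ checkPaths n (n ∸ length cycles) n paths

-- Soundness

module _ {n : ℕ} (G : Graph n) where

  adj-sym : ∀ {u v} → Adj G u v → Adj G v u
  adj-sym {u} {v} = trans (Graph.sym G v u)

  module _ {S : Subset n} where

    walk-start : ∀ {u v} → WalkAvoiding G S u v → u ∉ S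
    walk-start (here u∉)     = u∉
    walk-start (step u∉ _ _) = u∉

    walk-trans : ∀ {u v w} → WalkAvoiding G S u v → WalkAvoiding G S v w → WalkAvoiding G S u w
    walk-trans (here _)         q = q
    walk-trans (step u∉ edge p) q = step u∉ edge (walk-trans p q)

    walk-sym : ∀ {u v} → WalkAvoiding G S u v → WalkAvoiding G S v u
    walk-sym (here u∉)        = here u∉
    walk-sym (step u∉ edge p) =
      walk-trans (walk-sym p) (step (walk-start p) (adj-sym edge) (here u∉))

  forget : ∀ {S u v} → WalkAvoiding G S u v → Walk G u v
  forget (here _)        = here
  forget (step _ edge p) = step edge (forget p)

lookupOr-All : ∀ {A : Set} {P : A → Set} {d xs} → P d → All P xs → ∀ k → P (lookupOr d xs k)
lookupOr-All pd []         k       = pd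
lookupOr-All pd (px ∷ _)   zero    = px
lookupOr-All pd (_  ∷ pxs) (suc k) = lookupOr-All pd pxs k

module Soundness {n : ℕ} (G : Graph n) (minDegree : ∀ v → 4 ≤ degree G v)
  (cuts : ∀ S → Nonempty S → ComponentsAtMost G S ∣ S ∣) where

  Joined : Labelling n → Edge → Set
  Joined L (i , j) = Adj G (vertex L i) (vertex L j)

  Refuted : List Edge → Set
  Refuted P = ∀ L → ¬ All (Joined L) P

  -- The guards by `n` keep all labels in range: label n has no vertex of its own, so a path on n +
  -- 1 labels could be matched with a repeated vertex. For `p` equal to n the path clause is
  -- vacuous.
  Correct : Known → Set
  Correct (known b p lemmas) =
    (∀ k → b ≤ k → k ≤ n → Refuted (cycleEdges k)) ×
    (p < n → Refuted (pathEdges (suc p))) ×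
    All Refuted lemmas

  -- Stated for an arbitrary symmetric relation because it serves both the present edges and the
  -- absent ones.
  occurs-sound : ∀ {Q : ℕ → ℕ → Set} → (∀ {i j} → Q i j → Q j i) →
    ∀ {i j es} → All (λ (a , b) → Q a b) es → T (occurs i j es) → Q i j
  occurs-sound {Q} flip {i} {j} {(a , b) ∷ es} (q ∷ qs) t with ∨-case {(a ≡ᵇ i) ∧ (b ≡ᵇ j) ∨ (a ≡ᵇ j) ∧ (b ≡ᵇ i)} t
  ... | inj₂ t′ = occurs-sound {Q} flip qs t′
  ... | inj₁ t′ with ∨-case {(a ≡ᵇ i) ∧ (b ≡ᵇ j)} t′
  ...   | inj₁ t″ = let a≡i , b≡j = ∧-proj {a ≡ᵇ i} t″ in subst₂ Q (≡ᵇ⇒≡ a i a≡i) (≡ᵇ⇒≡ b j b≡j) q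
  ...   | inj₂ t″ = let a≡j , b≡i = ∧-proj {a ≡ᵇ j} t″ in flip (subst₂ Q (≡ᵇ⇒≡ a j a≡j) (≡ᵇ⇒≡ b i b≡i) q)

  module _ {K : Known} (correct : Correct K) where
    open Known K
    open Checker n K

    module _ (L : Labelling n) where

      Present Absent : List Edge → Set
      Present = All (Joined L)
      Absent  = All (¬_ ∘ Joined L)

      -- Under the labelling changed by `π`, the copy of `P` found inside `es` is `P` itself, which
      -- `refuted` excludes.
      matches-sound : ∀ π P {es} → Refuted P → T (matches π P es) → ¬ Present es
      matches-sound π P {es} refuted t present =
        let perm , t′ = ∧-proj {isPermutation n π} t
        in refuted (relabel L π perm)
             (All.map (λ {e} → occurs-sound {λ i j → Joined L (i , j)} (adj-sym G) {es = es} present)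
                      (All.all⁺ (λ (i , j) → occurs (nth π i) (nth π j) es) P t′))

      longCycle-sound : ∀ es c → T (longCycle es c) → ¬ Present es
      longCycle-sound es c t =
        let b≤ , t′ = ∧-proj {cycleBound ≤ᵇ length c} t
            ≤n , t″ = ∧-proj {length c ≤ᵇ n} t′
        in matches-sound (complete n c) (cycleEdges (length c))
             (proj₁ correct _ (≤ᵇ⇒≤ _ _ b≤) (≤ᵇ⇒≤ _ _ ≤n)) t″

      longPath-sound : pathBound < n → ∀ es p → T (longPath es p) → ¬ Present es
      longPath-sound p<n es p = matches-sound (complete n p) (pathEdges (suc pathBound)) (proj₁ (proj₂ correct) p<n)

      blocked-sound : ∀ es i j → T (blocked es i j) → Present es → ¬ Joined L (i , j)
      blocked-sound es i j t present e with ∨-case {longCycle ((i , j) ∷ es) (findCycle n es cycleBound i j)} t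
      ... | inj₁ t′ = longCycle-sound _ (findCycle n es cycleBound i j) t′ (e ∷ present)
      ... | inj₂ t′ with ∧-proj {pathBound <ᵇ n} t′
      ...   | p<n , t″ with ∨-case {longPath ((i , j) ∷ es) (findPath n es (suc pathBound) i j)} t″
      ...     | inj₁ t‴ = longPath-sound (<ᵇ⇒< _ _ p<n) _ (findPath n es (suc pathBound) i j) t‴ (e ∷ present)
      ...     | inj₂ t‴ = longPath-sound (<ᵇ⇒< _ _ p<n) _ (findPath n es (suc pathBound) j i) t‴ (e ∷ present)

      module _ (present absent : List Edge) (pres : Present present) (abs : Absent absent) where

        excluded-sound : ∀ i j → T (excluded present absent i j) → ¬ Joined L (i , j)
        excluded-sound i j t with ∨-case {occurs i j absent} t
        ... | inj₁ t′ = occurs-sound {λ i j → ¬ Joined L (i , j)} (_∘ adj-sym G) abs t′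
        ... | inj₂ t′ = blocked-sound present i j t′ pres

        -- Each neighbour carries a label that passes `mayBeAdjacent`, so the degree is at most the
        -- number of such labels, which is at most 3.
        degreeConflict-sound : ∀ v → ¬ T (degreeConflict present absent v)
        degreeConflict-sound v t =
          let v<n , few = ∧-proj {v <ᵇ n} t
          in <⇒≱ (s≤s (≤-trans (count-vertices-≤ L (adj G (vertex L v)) (mayBeAdjacent present absent v) possible)
                               (≤ᵇ⇒≤ _ 3 few)))
                 (minDegree (vertex L v))
          where
          possible : ∀ u → T (adj G (vertex L v) u) → T (mayBeAdjacent present absent v (label L u))
          possible u vu with occurs v (label L u) present
          ... | true  = _
          ... | false with (v ≡ᵇ label L u) ∨ excluded present absent v (label L u) in eq
          ...   | false = _
          ...   | true with ∨-case {v ≡ᵇ label L u} (Equivalence.from T-≡ eq)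
          ...     | inj₁ v≡u = contradiction
                    (trans (≡-sym (Graph.irrefl G u))
                           (trans (cong (λ w → adj G w u) (trans (≡-sym (vertex-label L u)) (cong (vertex L) (≡-sym (≡ᵇ⇒≡ v _ v≡u)))))
                                  (Equivalence.to T-≡ vu)))
                    (λ ())
          ...     | inj₂ ex = excluded-sound v (label L u) ex
                    (trans (cong (adj G (vertex L v)) (vertex-label L u)) (Equivalence.to T-≡ vu))

        module _ (χ : List ℕ) where

          S : Subset n
          S = tabulate (removed present absent χ ∘ label L)

          colour : Fin n → ℕ
          colour v = nth χ (label L v)

          ⇒∈S : ∀ v → T (removed present absent χ (label L v)) → v Subset.∈ S
          ⇒∈S v t = lookup⇒[]= v S (trans (lookup∘tabulate _ v) (Equivalence.to T-≡ t))

          ∉S⇒ : ∀ {v} → v ∉ S → ¬ T (removed present absent χ (label L v))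
          ∉S⇒ {v} v∉S = v∉S ∘ ⇒∈S v

          module _ (sep : ∀ {i j} → j < i → i < n → T (separated present absent χ i j)) where

            separated-sound : ∀ {u v} → u ∉ S → v ∉ S → label L v < label L u → Adj G u v → colour u ≡ colour v
            separated-sound {u} {v} u∉ v∉ v<u uv with ∨-case {removed present absent χ (label L u)} (sep v<u (label<n L u))
            ... | inj₁ t = contradiction t (∉S⇒ u∉)
            ... | inj₂ t with ∨-case {removed present absent χ (label L v)} t
            ...   | inj₁ t′ = contradiction t′ (∉S⇒ v∉)
            ...   | inj₂ t′ with ∨-case {nth χ (label L u) ≡ᵇ nth χ (label L v)} t′
            ...     | inj₁ t″ = ≡ᵇ⇒≡ _ _ t″
            ...     | inj₂ t″ = contradiction (subst₂ (Adj G) (≡-sym (vertex-label L u)) (≡-sym (vertex-label L v)) uv)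
                                              (excluded-sound _ _ t″)

            -- The check visits each pair once, with the larger label first; the other order follows
            -- from the symmetry of adjacency.
            adjacent-colours : ∀ {u v} → u ∉ S → v ∉ S → Adj G u v → colour u ≡ colour v
            adjacent-colours {u} {v} u∉ v∉ uv with <-cmp (label L u) (label L v)
            ... | tri< u<v _ _ = ≡-sym (separated-sound v∉ u∉ u<v (adj-sym G uv))
            ... | tri≈ _ u≡v _ = cong (nth χ) u≡v
            ... | tri> _ _ v<u = separated-sound u∉ v∉ v<u uv

            walk-colours : ∀ {u v} → WalkAvoiding G S u v → colour u ≡ colour v
            walk-colours (here _) = refl
            walk-colours (step u∉ uw walk) = trans (adjacent-colours u∉ (walk-start G walk) uw) (walk-colours walk)

          -- Colours are constant along walks avoiding `S`, so representatives of the colours 1,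
          -- ..., k + 1 lie in distinct components, whereas `S` has at most k elements.
          cutConflict-sound : ¬ T (cutConflict present absent χ)
          cutConflict-sound t =
            let some , t′ = ∧-proj {any (removed present absent χ) (upTo n)} t
                use , t″  = ∧-proj {all (used present absent χ) (upTo (suc (cutSize present absent χ)))} t′
                sep : ∀ {i j} → j < i → i < n → T (separated present absent χ i j)
                sep {i} j<i i<n = all-upTo⇒ i (all-upTo⇒ n t″ i<n) j<i
                i , i<n , ri = applyUpTo⁻ id (any⁻ (removed present absent χ) (upTo n) some)
                rep : ℕ → Fin n
                -- The shift by one leaves colour 0 to the vertices of the cut.
                rep c = vertex L (index χ (suc c))
                k = cutSize present absent χ
                colour-rep : ∀ {c} → c < suc k → colour (rep c) ≡ suc c
                colour-rep {c} c<k =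
                  let i<n , eq = ∧-proj {index χ (suc c) <ᵇ n} (all-upTo⇒ (suc k) use c<k)
                  in trans (cong (nth χ) (label-vertex L (<ᵇ⇒< _ _ i<n))) (≡ᵇ⇒≡ _ _ eq)
                rep∉S : ∀ {c} → c < suc k → rep c ∉ S
                rep∉S {c} c<k c∈S = contradiction
                  (trans (≡-sym (colour-rep c<k))
                         (≡ᵇ⇒≡ (colour (rep c)) 0
                           (Equivalence.from T-≡ (trans (≡-sym (lookup∘tabulate _ (rep c))) ([]=⇒lookup c∈S)))))
                  (λ ())
                apart : AllPairs (λ u v → ¬ WalkAvoiding G S u v) (applyUpTo rep (suc k))
                apart = AllPairs.applyUpTo⁺₁ rep (suc k) λ i<j j<k walk → <⇒≢ i<j (suc-injective
                  (trans (≡-sym (colour-rep (<-trans i<j j<k))) (trans (walk-colours sep walk) (colour-rep j<k))))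
                ∣S∣≤k : ∣ S ∣ ≤ k
                ∣S∣≤k = ≤-trans (≤-reflexive (∣tabulate∣≡length-filterᵇ (removed present absent χ ∘ label L) id))
                          (count-vertices-≤ L (removed present absent χ ∘ label L) (removed present absent χ) (λ _ → id))
                nonempty : Nonempty S
                nonempty = vertex L i , ⇒∈S (vertex L i) (subst (T ∘ removed present absent χ) (≡-sym (label-vertex L i<n)) ri)
            in <⇒≱ (s≤s ∣S∣≤k) (≤-trans (≤-reflexive (≡-sym (length-applyUpTo rep (suc k))))
                  (cuts S nonempty (applyUpTo rep (suc k)) (All.applyUpTo⁺₁ rep (suc k) rep∉S) apart))

      check-sound : ∀ c present absent → T (check c present absent) → Present present → ¬ Absent absent
      check-sound (branch i j c d) present absent t pres abs =
        let tc , td = ∧-proj {check c ((i , j) ∷ present) absent} t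
        -- Adjacency is not decided: the first certificate proves the pair nonadjacent, and this is
        -- what the second one assumes.
        in check-sound d present ((i , j) ∷ absent) td pres
             ((λ e → check-sound c ((i , j) ∷ present) absent tc (e ∷ pres) abs) ∷ abs)
      check-sound (lowDegree v) present absent t pres abs = degreeConflict-sound present absent pres abs v t
      check-sound (cut χ)       present absent t pres abs = cutConflict-sound present absent pres abs (word χ) t
      check-sound (lemma k π)   present absent t pres abs =
        matches-sound (word π) (lookupOr ((0 , 0) ∷ []) lemmas k) (lookupOr-All loop (proj₂ (proj₂ correct)) k) t pres
        where
        loop : Refuted ((0 , 0) ∷ [])
        loop L′ (e ∷ []) = contradiction (trans (≡-sym (Graph.irrefl G (vertex L′ 0))) e) (λ ())

  -- Soundness of stages and whole refutations

  checkLemmas-sound : ∀ b p base ps lemmas main → Correct (known b p ps) →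
    T (checkLemmas n b p base ps lemmas main) → Refuted base
  checkLemmas-sound b p base ps [] main ok t L pres = check-sound ok L main base [] t pres []
  checkLemmas-sound b p base ps ((P , c) ∷ rest) main ok@(cyc , path , refs) t =
    let t₁ , t₂ = ∧-proj {Checker.check n (known b p ps) c (edges P) []} t
    in checkLemmas-sound b p base (edges P ∷ ps) rest main
         (cyc , path , (λ L pres → check-sound ok L c (edges P) [] t₁ pres []) ∷ refs) t₂

  CyclesRefuted : ℕ → Set
  CyclesRefuted b = ∀ k → b ≤ k → k ≤ n → Refuted (cycleEdges k)

  checkCycles-sound : ∀ b ss → T (checkCycles n b ss) → CyclesRefuted b → CyclesRefuted (b ∸ length ss)
  checkCycles-sound b       []                       t cyc = cyc
  checkCycles-sound (suc b) (stage lemmas main ∷ ss) t cyc =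
    let t₁ , t₂ = ∧-proj {checkStage n (suc b) n (cycleEdges b) (stage lemmas main)} t
        new : Refuted (cycleEdges b)
        new = checkLemmas-sound (suc b) n (cycleEdges b) [] lemmas main (cyc , (λ n<n → contradiction n<n (n≮n n)) , []) t₁
    in checkCycles-sound b ss t₂ λ k b≤k k≤n → case k b≤k k≤n new
    where
    case : ∀ k → b ≤ k → k ≤ n → Refuted (cycleEdges b) → Refuted (cycleEdges k)
    case k b≤k k≤n new with m≤n⇒m<n∨m≡n b≤k
    ... | inj₁ b<k  = cyc k b<k k≤n
    ... | inj₂ refl = new

  checkPaths-sound : ∀ b p ss → T (checkPaths n b p ss) → CyclesRefuted b →
    (p < n → Refuted (pathEdges (suc p))) → 0 < n → Refuted []
  checkPaths-sound b p [] t cyc path 0<n with ≡ᵇ⇒≡ p 0 t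
  -- The pattern `pathEdges 1` evaluates to `[]`.
  ... | refl = path 0<n
  checkPaths-sound b (suc p) (stage lemmas main ∷ ss) t cyc path =
    let t₁ , t₂ = ∧-proj {checkStage n b (suc p) (pathEdges (suc p)) (stage lemmas main)} t
    in checkPaths-sound b p ss t₂ cyc λ _ →
         checkLemmas-sound b (suc p) (pathEdges (suc p)) [] lemmas main (cyc , path , []) t₁

  spanning-cycle : 3 ≤ n → ∀ L → All (Joined L) (cycleEdges n) → SpanningCycle G
  spanning-cycle (s≤s 2≤m) L (closing ∷ path) =
    -- The whole list of vertices is `applyUpTo (vertex L) n` by computation, so distinctness and
    -- adjacency can be read off uniformly in the index.
    vertex L 0 , applyUpTo (vertex L ∘ suc) _ , s≤s 2≤m , cong suc (length-applyUpTo _ _) ,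
    AllPairs.applyUpTo⁺₁ (vertex L) _ (λ i<j j<n eq → <⇒≢ i<j (vertex-injective L (<-trans i<j j<n) j<n eq)) ,
    linked _ (vertex L) (λ i<m → All.applyUpTo⁻ (λ i → i , suc i) _ path i<m) closing
    where
    linked : ∀ m (f : ℕ → Fin n) {x} → (∀ {i} → i < m → Adj G (f i) (f (suc i))) → Adj G (f m) x →
      Linked (Adj G) (applyUpTo f (suc m) ++ [ x ])
    linked zero    f edge last = last ∷ [-]
    linked (suc m) f edge last = edge (s≤s z≤n) ∷ linked m (f ∘ suc) (edge ∘ s≤s) last

  refute : ¬ SpanningCycle G → 3 ≤ n → ∀ r → T (checkRefutation n r) → ⊥
  refute nonhamiltonian 3≤n (refutation cycles paths) t =
    let t₁ , t₂ = ∧-proj {checkCycles n n cycles} t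
        cyc : CyclesRefuted n
        cyc k n≤k k≤n L pres = nonhamiltonian (spanning-cycle 3≤n L (subst (All (Joined L) ∘ cycleEdges) (≤-antisym k≤n n≤k) pres))
    in checkPaths-sound (n ∸ length cycles) n paths t₂ (checkCycles-sound n cycles t₁ cyc)
         -- The empty pattern holds under every labelling, and n being positive there is one.
         (λ n<n → contradiction n<n (n≮n n)) 0<n (identity (fromℕ< 0<n)) []
    where
    0<n : 0 < n
    0<n = ≤-trans (s≤s z≤n) 3≤n

-- The certificates for n = 4, …, 12

-- The end of a path on at most four vertices that cannot be prolonged has at most three neighbours.
shortPaths : ℕ → List Stage
shortPaths k = replicate k (stage [] (lowDegree 0))

certificate4 : Refutation
certificate4 = refutation
  []
  (shortPaths 4)

certificate5 : Refutation
certificate5 = refutation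
  []
  (stage [] (lowDegree 0) ∷ shortPaths 4)

certificate6 : Refutation
certificate6 = refutation
  []
  (
    stage [] (branch 0 2 (lowDegree 5) (lowDegree 0)) ∷
    stage [] (lowDegree 5) ∷ shortPaths 4)

certificate7 : Refutation
certificate7 = refutation
  []
  (
    stage (
      -- The edges 01, 02, 12, 23, 34, 45, 56: the path on seven vertices with the chord 02. The
      -- main certificate applies it as it stands by 0x10123456 and to the reversed path by
      -- 0x16543210.
      (0x101021223344556 , branch 2 6 (branch 0 4 (lowDegree 1) (lowDegree 0)) (lowDegree 6)) ∷
      []) (branch 0 2 (lemma 0 0x10123456) (branch 0 3 (branch 4 6 (lemma 0 0x16543210) (lowDegree 6))
        (lowDegree 0))) ∷
    stage [] (branch 1 6 (branch 0 3 (lowDegree 5) (lowDegree 0)) (lowDegree 6)) ∷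
    stage [] (branch 0 2 (lowDegree 5) (lowDegree 0)) ∷ shortPaths 4)

certificate8 : Refutation
certificate8 = refutation
  []
  (
    stage (
      (0x1011223343745475667 , lowDegree 0) ∷
      (0x1010203122334455667 , branch 3 7 (branch 4 7 (lemma 0 0x101234567) (lowDegree 4)) (lowDegree 7)) ∷
      (0x1010204122334455667 , branch 2 7 (lowDegree 3) (lowDegree 7)) ∷
      (0x10102122334455667 , branch 0 3 (lemma 1 0x101234567) (branch 0 4 (lemma 0 0x101234567)
        (branch 0 5 (branch 0 6 (lowDegree 7) (branch 0 3 (lemma 1 0x101234567) (branch 0 4 (lemma 0
        0x101234567) (lowDegree 0)))) (lowDegree 0)))) ∷
      (0x10103122334455667 , branch 0 5 (branch 5 7 (lemma 0 0x176543210) (lowDegree 7)) (branch 0 2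
        (lemma 0 0x101234567) (branch 0 4 (lemma 3 0x176543210) (lowDegree 0)))) ∷
      []) (branch 0 2 (lemma 1 0x101234567) (branch 0 3 (lemma 0 0x101234567) (branch 0 4 (branch 4 7
        (lemma 0 0x176543210) (branch 5 7 (lemma 1 0x176543210) (lowDegree 7))) (lowDegree 0)))) ∷
    stage (
      (0x101061223344556 , lowDegree 7) ∷
      (0x101021223344556 , branch 2 7 (branch 5 7 (lowDegree 6) (lowDegree 7)) (lowDegree 7)) ∷
      []) (branch 0 6 (lemma 1 0x101234567) (branch 0 2 (lemma 0 0x101234567) (branch 0 3 (branch 0 4
        (lowDegree 7) (branch 0 2 (lemma 0 0x101234567) (branch 0 6 (lemma 1 0x101234567) (lowDegree
        0)))) (lowDegree 0)))) ∷
    stage (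
      (0x1010512233445 , lowDegree 6) ∷
      []) (branch 0 5 (lemma 0 0x101234567) (branch 0 2 (branch 0 3 (lowDegree 6) (branch 0 5 (lemma 0
        0x101234567) (lowDegree 0))) (lowDegree 0))) ∷
    stage [] (branch 0 4 (lowDegree 5) (lowDegree 0)) ∷ shortPaths 4)

-- In each cycle stage from here on, the lemma listed last is the cycle with a pendant edge. The
-- main certificate applies it, rotated, at n - 4 vertices of the cycle; of the n - 1 possible
-- neighbours of an outside vertex only three then remain.
certificate9 : Refutation
certificate9 = refutation
  (
    stage (
      (0x101070812233438455667 , branch 5 8 (lowDegree 4) (lowDegree 8)) ∷
      (0x1010708122334455667 , branch 3 8 (lemma 0 0x1012345678) (branch 4 8 (branch 2 8 (branch 1 6
        (cut 0x1010203045) (lowDegree 1)) (lowDegree 8)) (branch 5 8 (lemma 0 0x1076543218) (lowDegree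
        8)))) ∷
      []) (branch 0 8 (lemma 0 0x1012345678) (branch 1 8 (lemma 0 0x1123456708) (branch 2 8 (lemma 0
        0x1234567018) (branch 3 8 (lemma 0 0x1345670128) (branch 4 8 (lemma 0 0x1456701238) (lowDegree
        8)))))) ∷ [])
  (
    stage (
      (0x1010512233445566778 , branch 2 8 (lowDegree 0) (lowDegree 8)) ∷
      []) (branch 0 4 (branch 4 8 (branch 0 3 (cut 0x1111102222) (lowDegree 0)) (lowDegree 8)) (branch
        0 5 (lemma 0 0x1012345678) (branch 0 6 (branch 3 8 (lemma 0 0x1876543210) (lowDegree 8))
        (lowDegree 0)))) ∷
    stage (
      (0x1010212232734455667 , branch 2 8 (branch 4 8 (branch 3 5 (lowDegree 0) (lowDegree 3))
        (lowDegree 8)) (lowDegree 8)) ∷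
      (0x1011223343745475667 , lowDegree 0) ∷
      (0x10102122334455667 , branch 2 7 (lemma 1 0x1012345678) (branch 3 7 (branch 4 7 (lemma 0
        0x1012345678) (branch 2 7 (lemma 1 0x1012345678) (lowDegree 7))) (lowDegree 7))) ∷
      (0x10103122334455667 , branch 0 5 (branch 5 7 (lemma 0 0x1765432108) (lowDegree 7)) (branch 0 2
        (lemma 0 0x1012345678) (branch 0 4 (lemma 1 0x1765432108) (lowDegree 0)))) ∷
      []) (branch 0 2 (lemma 1 0x1012345678) (branch 0 3 (lemma 0 0x1012345678) (branch 0 4 (branch 4
        7 (lemma 0 0x1765432108) (branch 5 7 (lemma 1 0x1765432108) (lowDegree 7))) (lowDegree 0)))) ∷
    stage (
      (0x101061223344556 , lowDegree 7) ∷
      (0x101021623344556 , lowDegree 7) ∷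
      (0x101021223344556 , branch 1 6 (lemma 0 0x1012345678) (branch 2 6 (branch 3 6 (lowDegree 7)
        (branch 0 6 (lemma 1 0x1012345678) (branch 1 6 (lemma 0 0x1012345678) (lowDegree 6)))) (branch
        0 6 (lemma 1 0x1012345678) (lowDegree 6)))) ∷
      []) (branch 0 6 (lemma 2 0x1012345678) (branch 0 2 (lemma 0 0x1012345678) (branch 0 3 (branch 0
        4 (lowDegree 7) (branch 0 2 (lemma 0 0x1012345678) (branch 0 6 (lemma 2 0x1012345678)
        (lowDegree 0)))) (lowDegree 0)))) ∷
    stage (
      (0x1010512233445 , lowDegree 6) ∷
      []) (branch 0 5 (lemma 0 0x1012345678) (branch 0 2 (branch 1 5 (lowDegree 6) (branch 0 5 (lemma
        0 0x1012345678) (lowDegree 5))) (lowDegree 0))) ∷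
    stage [] (branch 0 4 (lowDegree 5) (lowDegree 0)) ∷ shortPaths 4)

certificate10 : Refutation
certificate10 = refutation
  (
    stage (
      (0x10108091223343945566778 , branch 6 9 (lowDegree 9) (branch 5 9 (branch 4 7 (cut
        0x10110203045) (lowDegree 4)) (lowDegree 9))) ∷
      (0x10108091223344549566778 , branch 6 9 (lemma 0 0x10876543219) (branch 7 9 (lemma 0
        0x14567801239) (lowDegree 9))) ∷
      (0x101080912233445566778 , branch 3 9 (lemma 1 0x10123456789) (branch 4 9 (lemma 0
        0x10123456789) (branch 5 9 (lemma 0 0x10876543219) (branch 6 9 (lemma 1 0x10876543219)
        (lowDegree 9))))) ∷
      []) (branch 0 9 (lemma 0 0x10123456789) (branch 1 9 (lemma 0 0x11234567809) (branch 2 9 (lemma 0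
        0x12345678019) (branch 3 9 (lemma 0 0x13456780129) (branch 4 9 (lemma 0 0x14567801239) (branch
        5 9 (lemma 0 0x15678012349) (lowDegree 9))))))) ∷
    stage (
      (0x10107081223343845566789 , lowDegree 9) ∷
      (0x101070812233438455667 , branch 8 9 (lemma 0 0x10123456789) (branch 5 8 (branch 8 9 (lemma 0
        0x10123456789) (lowDegree 8)) (lowDegree 8))) ∷
      (0x10107081223344548566789 , lowDegree 9) ∷
      (0x1010708121923283445485667 , lowDegree 9) ∷
      (0x101070812233445485667 , branch 8 9 (lemma 1 0x10123456789) (branch 2 8 (branch 6 8 (branch 1
        9 (lemma 0 0x10123456789) (branch 3 9 (lemma 0 0x12345670189) (branch 5 9 (lemma 0
        0x14567012389) (branch 7 9 (lemma 0 0x10765432189) (branch 8 9 (lemma 1 0x10123456789) (cut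
        0x10101020345)))))) (branch 8 9 (lemma 1 0x10123456789) (lowDegree 8))) (lowDegree 8))) ∷
      (0x1010708122334455667 , branch 2 8 (branch 4 8 (lemma 0 0x10123456789) (branch 5 8 (lemma 3
        0x10765432189) (branch 6 8 (lemma 0 0x12345670189) (lowDegree 8)))) (branch 3 8 (lemma 3
        0x10123456789) (branch 4 8 (lemma 0 0x10123456789) (branch 5 8 (lemma 3 0x10765432189)
        (lowDegree 8))))) ∷
      []) (branch 0 8 (lemma 0 0x10123456789) (branch 1 8 (lemma 0 0x11234567089) (branch 2 8 (lemma 0
        0x12345670189) (branch 3 8 (lemma 0 0x13456701289) (branch 4 8 (lemma 0 0x14567012389) (branch
        5 8 (lemma 0 0x15670123489) (lowDegree 8))))))) ∷ [])
  (
    stage (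
      (0x101061223344556677889 , lowDegree 9) ∷
      (0x101051223344556677889 , branch 5 9 (branch 6 9 (cut 0x11111102222) (lowDegree 6)) (lowDegree 9)) ∷
      (0x101030412152334455659676989 , cut 0x11111102222) ∷
      []) (branch 0 6 (lemma 2 0x10123456789) (branch 0 5 (lemma 1 0x10123456789) (branch 0 4 (branch
        0 3 (branch 5 9 (branch 6 9 (branch 1 5 (lemma 0 0x10123456789) (branch 1 3 (branch 1 4
        (branch 5 8 (branch 6 8 (branch 2 5 (cut 0x11111102222) (branch 3 5 (cut 0x11111102222)
        (branch 0 5 (lemma 1 0x10123456789) (branch 1 5 (lemma 0 0x10123456789) (cut
        0x11111022222))))) (branch 4 8 (lemma 0 0x19876543210) (lowDegree 8))) (branch 4 8 (lemma 0
        0x19876543210) (lowDegree 8))) (branch 1 5 (lemma 0 0x10123456789) (lowDegree 1))) (lowDegree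
        1))) (branch 4 9 (lemma 1 0x19876543210) (lowDegree 9))) (branch 4 9 (lemma 1 0x19876543210)
        (lowDegree 9))) (branch 0 5 (lemma 1 0x10123456789) (branch 0 6 (lemma 2 0x10123456789)
        (lowDegree 0)))) (lowDegree 0)))) ∷
    stage (
      (0x1010512233445566778 , branch 2 8 (lowDegree 0) (lowDegree 8)) ∷
      []) (branch 0 4 (branch 4 8 (branch 0 3 (lowDegree 9) (lowDegree 0)) (lowDegree 8)) (branch 0 5
        (lemma 0 0x10123456789) (branch 0 6 (branch 3 8 (lemma 0 0x18765432109) (lowDegree 8))
        (lowDegree 0)))) ∷
    stage (
      (0x1010203122334455667 , branch 3 7 (branch 4 6 (lowDegree 8) (lowDegree 4)) (lowDegree 7)) ∷
      (0x1010204122334455667 , branch 2 7 (lowDegree 3) (lowDegree 7)) ∷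
      (0x10102122334455667 , branch 0 3 (lemma 1 0x10123456789) (branch 0 4 (lemma 0 0x10123456789)
        (branch 0 5 (branch 0 6 (lowDegree 7) (branch 0 3 (lemma 1 0x10123456789) (branch 0 4 (lemma 0
        0x10123456789) (lowDegree 0)))) (lowDegree 0)))) ∷
      (0x10103122334455667 , branch 4 7 (branch 0 2 (lemma 0 0x10123456789) (branch 5 7 (lemma 0
        0x17654321089) (cut 0x11020030455))) (branch 5 7 (lemma 0 0x17654321089) (lowDegree 7))) ∷
      []) (branch 0 2 (lemma 1 0x10123456789) (branch 0 3 (lemma 0 0x10123456789) (branch 0 4 (branch
        4 7 (lemma 0 0x17654321089) (branch 5 7 (lemma 1 0x17654321089) (lowDegree 7))) (lowDegree
        0)))) ∷
    stage (
      (0x101061223344556 , lowDegree 7) ∷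
      (0x101021623344556 , lowDegree 7) ∷
      (0x101021223344556 , branch 1 6 (lemma 0 0x10123456789) (branch 2 6 (branch 3 6 (lowDegree 7)
        (branch 0 6 (lemma 1 0x10123456789) (branch 1 6 (lemma 0 0x10123456789) (lowDegree 6))))
        (branch 0 6 (lemma 1 0x10123456789) (lowDegree 6)))) ∷
      []) (branch 0 6 (lemma 2 0x10123456789) (branch 0 2 (lemma 0 0x10123456789) (branch 0 3 (branch
        2 6 (lowDegree 7) (branch 0 6 (lemma 2 0x10123456789) (branch 4 6 (lemma 0 0x16543210789)
        (lowDegree 6)))) (lowDegree 0)))) ∷
    stage (
      (0x1010512233445 , lowDegree 6) ∷
      []) (branch 0 5 (lemma 0 0x10123456789) (branch 0 2 (branch 1 5 (lowDegree 6) (branch 0 5 (lemma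
        0 0x10123456789) (lowDegree 5))) (lowDegree 0))) ∷
    -- When the ends of a longest path are adjacent, no edge leaves the resulting cycle, as it would
    -- give a longer path. For n = 10 five vertices lie outside and may all have degree 4 among
    -- themselves, so `lowDegree` no longer applies to them; removing one vertex of the cycle gives
    -- a cut with two parts.
    stage [] (branch 0 4 (cut 0x10111122222) (lowDegree 0)) ∷ shortPaths 4)

certificate11 : Refutation
certificate11 = refutation
  (
    stage (
      (0x10107091223343a4556676a78898a , branch 3 7 (branch 1 5 (lowDegree 2) (cut 0x101102203045))
        (lowDegree 7)) ∷
      (0x101090a1223343a4556676a7889 , branch 8 10 (branch 0 7 (lemma 0 0x10123456789a) (lowDegree 7))
        (lowDegree 10)) ∷
      (0x101090a1223343a4556677889 , branch 6 10 (lemma 0 0x10123456789a) (branch 7 10 (lemma 0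
        0x13210987654a) (branch 5 10 (branch 0 4 (branch 4 8 (branch 3 9 (cut 0x101102033045)
        (lowDegree 9)) (branch 4 7 (lemma 1 0x17890123456a) (lowDegree 4))) (branch 4 7 (lemma 1
        0x17890123456a) (lowDegree 4))) (lowDegree 10)))) ∷
      (0x101090a12232a34454a56676a7889 , branch 7 9 (cut 0x101020304445) (cut 0x101020304056)) ∷
      (0x101090a12232a34454a56677889 , branch 6 10 (lemma 0 0x10123456789a) (branch 8 10 (lemma 0
        0x14321098765a) (branch 7 10 (lemma 1 0x10987654321a) (lowDegree 10)))) ∷
      (0x101090a122334454a56677889 , branch 2 10 (lemma 0 0x10123456789a) (branch 6 10 (branch 2 10
        (lemma 0 0x10123456789a) (branch 8 10 (lemma 0 0x10987654321a) (lowDegree 10))) (branch 7 10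
        (lemma 2 0x10987654321a) (lowDegree 10)))) ∷
      (0x101090a1223344556677889 , branch 3 10 (lemma 3 0x10123456789a) (branch 4 10 (lemma 0
        0x10123456789a) (branch 5 10 (branch 2 10 (lemma 3 0x12345678901a) (branch 3 10 (lemma 3
        0x10123456789a) (branch 7 10 (lemma 3 0x10987654321a) (branch 8 10 (lemma 3 0x15678901234a)
        (lowDegree 10))))) (branch 6 10 (lemma 0 0x10987654321a) (branch 7 10 (lemma 3 0x10987654321a)
        (lowDegree 10)))))) ∷
      []) (branch 0 10 (lemma 0 0x10123456789a) (branch 1 10 (lemma 0 0x11234567890a) (branch 2 10
        (lemma 0 0x12345678901a) (branch 3 10 (lemma 0 0x13456789012a) (branch 4 10 (lemma 0
        0x14567890123a) (branch 5 10 (lemma 0 0x15678901234a) (branch 6 10 (lemma 0 0x16789012345a)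
        (lowDegree 10)))))))) ∷
    stage (
      (0x1010809122334394556676978 , branch 9 10 (branch 0 10 (cut 0x101102203344) (lowDegree 10))
        (lowDegree 9)) ∷
      (0x101080912233439455667789a , branch 6 10 (branch 6 9 (lemma 0 0x10123456789a) (lowDegree 9))
        (lowDegree 10)) ∷
      (0x101080912233439454a56596778 , lowDegree 10) ∷
      (0x10108091223343945566778 , branch 6 9 (lemma 2 0x10123456789a) (branch 9 10 (lemma 1
        0x10123456789a) (branch 5 9 (branch 4 10 (lemma 0 0x10123456789a) (branch 0 4 (branch 4 7
        (branch 7 9 (branch 6 10 (lowDegree 10) (branch 4 10 (lemma 0 0x10123456789a) (branch 8 10
        (lemma 0 0x13210876549a) (branch 9 10 (lemma 1 0x10123456789a) (cut 0x105501020345)))))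
        (branch 9 10 (lemma 1 0x10123456789a) (lowDegree 9))) (branch 4 10 (lemma 0 0x10123456789a)
        (lowDegree 4))) (lowDegree 4))) (lowDegree 9)))) ∷
      (0x10108091223344549566778 , branch 9 10 (lowDegree 10) (branch 6 9 (lemma 0 0x10876543219a)
        (branch 7 9 (lemma 0 0x14567801239a) (lowDegree 9)))) ∷
      (0x101080912233445566778 , branch 2 9 (branch 4 9 (lemma 0 0x10123456789a) (branch 5 9 (lemma 1
        0x12345678019a) (branch 6 9 (lemma 1 0x10876543219a) (branch 7 9 (lemma 0 0x12108765439a)
        (lowDegree 9))))) (branch 3 9 (lemma 1 0x10123456789a) (branch 4 9 (lemma 0 0x10123456789a)
        (branch 5 9 (lemma 0 0x10876543219a) (branch 6 9 (lemma 1 0x10876543219a) (lowDegree 9)))))) ∷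
      []) (branch 0 9 (lemma 0 0x10123456789a) (branch 1 9 (lemma 0 0x11234567809a) (branch 2 9 (lemma
        0 0x12345678019a) (branch 3 9 (lemma 0 0x13456780129a) (branch 4 9 (lemma 0 0x14567801239a)
        (branch 5 9 (lemma 0 0x15678012349a) (branch 6 9 (lemma 0 0x16780123459a) (lowDegree 9))))))))
        ∷
    stage (
      (0x10107081223343845566789 , branch 9 10 (lowDegree 10) (lowDegree 9)) ∷
      (0x101070812233438455667 , branch 8 9 (lemma 0 0x10123456789a) (branch 8 10 (lemma 0
        0x1012345678a9) (branch 5 8 (branch 8 9 (lemma 0 0x10123456789a) (branch 8 10 (lemma 0
        0x1012345678a9) (lowDegree 8))) (lowDegree 8)))) ∷
      (0x10107081223344548566789 , branch 0 9 (branch 8 10 (branch 9 10 (cut 0x101110222333)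
        (lowDegree 9)) (lowDegree 8)) (lowDegree 9)) ∷
      (0x1010708121923283445485667 , lowDegree 9) ∷
      (0x101070812233445485667 , branch 8 9 (lemma 1 0x10123456789a) (branch 8 10 (lemma 1
        0x1012345678a9) (branch 2 8 (branch 6 8 (branch 1 9 (lemma 0 0x10123456789a) (branch 3 9
        (lemma 0 0x12345670189a) (branch 1 10 (lemma 0 0x1012345678a9) (branch 3 10 (lemma 0
        0x1234567018a9) (branch 5 9 (lemma 0 0x14567012389a) (branch 5 10 (lemma 0 0x1456701238a9)
        (branch 7 9 (lemma 0 0x10765432189a) (branch 7 10 (lemma 0 0x1076543218a9) (branch 8 9 (lemma
        1 0x10123456789a) (branch 8 10 (lemma 1 0x1012345678a9) (cut 0x101010203455))))))))))) (branch
        8 9 (lemma 1 0x10123456789a) (branch 8 10 (lemma 1 0x1012345678a9) (lowDegree 8)))) (lowDegree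
        8)))) ∷
      (0x10107081223283445566789 , lowDegree 9) ∷
      (0x101070812233445566789 , branch 2 8 (lemma 0 0x10123456789a) (branch 6 8 (lemma 0
        0x10765432189a) (branch 3 8 (lemma 4 0x10123456789a) (branch 4 8 (lemma 1 0x10123456789a)
        (branch 5 8 (lemma 4 0x10765432189a) (lowDegree 8)))))) ∷
      (0x1010708122334455667 , branch 3 8 (lemma 5 0x10123456789a) (branch 4 8 (lemma 2
        0x10123456789a) (branch 5 8 (lemma 5 0x10765432189a) (branch 8 9 (lemma 0 0x10123456789a)
        (branch 8 10 (lemma 0 0x1012345678a9) (lowDegree 8)))))) ∷
      []) (branch 0 8 (lemma 0 0x10123456789a) (branch 1 8 (lemma 0 0x11234567089a) (branch 2 8 (lemma
        0 0x12345670189a) (branch 3 8 (lemma 0 0x13456701289a) (branch 4 8 (lemma 0 0x14567012389a)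
        (branch 5 8 (lemma 0 0x15670123489a) (branch 6 8 (lemma 0 0x16701234589a) (lowDegree 8))))))))
        ∷ [])
  (
    stage (
      (0x1010612233445566778899a , branch 6 10 (cut 0x111111102222) (lowDegree 10)) ∷
      (0x1010512233445565a6778899a , branch 2 8 (lowDegree 0) (cut 0x111111022222)) ∷
      (0x10105122334455657676a787a899a , cut 0x111111022222) ∷
      (0x101051223344556586778797a899a , cut 0x111111022222) ∷
      (0x1010512233445566778899a , branch 5 10 (lemma 2 0x10123456789a) (branch 6 10 (branch 7 10
        (branch 5 7 (lemma 1 0x10123456789a) (branch 7 9 (branch 5 9 (cut 0x111111022222) (branch 5 7
        (lemma 1 0x10123456789a) (branch 5 8 (lemma 0 0x10123456789a) (branch 5 10 (lemma 2
        0x10123456789a) (cut 0x111111102222))))) (lowDegree 7))) (branch 5 10 (lemma 2 0x10123456789a)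
        (lowDegree 10))) (lowDegree 10))) ∷
      (0x10104121623344556676a787a899a , cut 0x111111102222) ∷
      (0x1041213142325344556596a787a899a , cut 0x111111022222) ∷
      (0x104121314232434354556596a787a899a , cut 0x111111022222) ∷
      (0x101041213142334455659676a787a899a , branch 2 5 (lemma 1 0x10123456789a) (branch 2 4 (branch 1
        5 (cut 0x111111022222) (branch 3 5 (lemma 0 0x10123456789a) (branch 0 5 (lemma 3
        0x10123456789a) (branch 2 5 (lemma 1 0x10123456789a) (cut 0x111110222222))))) (lowDegree 2)))
        ∷
      (0x104121426344556696a78797a899a , cut 0x111111102222) ∷
      (0x10414243435455658676a787a899a , cut 0x111111022222) ∷
      (0x1010304121423243445565867696a78797a899a , branch 2 5 (cut 0x111111022222) (branch 3 5 (lemma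
        0 0x10123456789a) (branch 0 5 (lemma 6 0x10123456789a) (branch 1 5 (lemma 4 0x1a9876543210)
        (cut 0x111110222222))))) ∷
      (0x101030412131423344556676a787a899a , branch 5 9 (lemma 3 0x10123456789a) (branch 6 9 (branch 7
        9 (branch 2 6 (lemma 2 0x10123456789a) (branch 2 4 (branch 5 8 (lemma 0 0x10123456789a)
        (branch 6 8 (branch 3 5 (branch 5 7 (cut 0x111111022222) (branch 0 5 (lemma 7 0x10123456789a)
        (branch 1 5 (lemma 3 0x1a9876543210) (branch 2 5 (lemma 0 0x1a9876543210) (branch 5 8 (lemma 1
        0x10123456789a) (branch 5 9 (lemma 4 0x10123456789a) (branch 5 10 (lemma 7 0x1a9876543210)
        (lowDegree 5)))))))) (branch 0 5 (lemma 7 0x10123456789a) (branch 1 5 (lemma 3 0x1a9876543210)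
        (branch 2 5 (lemma 0 0x1a9876543210) (branch 5 8 (lemma 0 0x10123456789a) (branch 5 9 (lemma 3
        0x10123456789a) (branch 5 10 (lemma 7 0x1a9876543210) (lowDegree 5)))))))) (branch 4 8 (lemma
        2 0x1a9876543210) (lowDegree 8)))) (branch 2 5 (branch 5 8 (cut 0x111111022222) (branch 6 8
        (lemma 0 0x1a9876543210) (lowDegree 8))) (lowDegree 2)))) (branch 4 9 (lemma 6 0x1a9876543210)
        (branch 5 9 (lemma 3 0x10123456789a) (lowDegree 9)))) (branch 4 9 (lemma 6 0x1a9876543210)
        (lowDegree 9)))) ∷
      (0x1010304121323344556676a787a899a , branch 1 4 (lemma 0 0x10123456789a) (branch 1 5 (branch 4 6
        (cut 0x111111102222) (branch 2 4 (branch 5 7 (cut 0x111111022222) (branch 7 9 (branch 5 9 (cut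
        0x111111022222) (branch 6 9 (lemma 4 0x1a9876543210) (lowDegree 9))) (lowDegree 7))) (branch 1
        4 (lemma 0 0x10123456789a) (lowDegree 4)))) (branch 1 6 (lemma 7 0x10123456789a) (lowDegree
        1)))) ∷
      []) (branch 0 3 (branch 0 4 (branch 6 10 (branch 7 10 (branch 1 6 (lemma 8 0x10123456789a)
        (branch 1 3 (lemma 0 0x10123456789a) (branch 1 4 (branch 1 5 (branch 5 7 (cut 0x111111022222)
        (branch 7 9 (lemma 0 0x1a9876543210) (lowDegree 7))) (branch 1 3 (lemma 0 0x10123456789a)
        (branch 1 6 (lemma 8 0x10123456789a) (lowDegree 1)))) (lowDegree 1)))) (branch 4 10 (lemma 13
        0x1a9876543210) (branch 5 10 (lemma 9 0x1a9876543210) (lowDegree 10)))) (branch 4 10 (lemma 13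
        0x1a9876543210) (branch 5 10 (lemma 9 0x1a9876543210) (lowDegree 10)))) (branch 0 5 (lemma 9
        0x10123456789a) (branch 0 6 (lemma 13 0x10123456789a) (lowDegree 0)))) (branch 0 5 (lemma 9
        0x10123456789a) (branch 0 6 (lemma 13 0x10123456789a) (lowDegree 0)))) ∷
    stage (
      (0x101061223344556677889 , lowDegree 9) ∷
      (0x101051223344556677889 , branch 5 9 (branch 6 9 (cut 0x122222011112) (lowDegree 6)) (lowDegree 9)) ∷
      []) (branch 0 6 (lemma 1 0x10123456789a) (branch 0 5 (lemma 0 0x10123456789a) (branch 0 4
        (branch 0 2 (branch 0 3 (branch 5 9 (branch 6 9 (lowDegree 10) (branch 4 9 (lemma 0
        0x19876543210a) (lowDegree 9))) (branch 4 9 (lemma 0 0x19876543210a) (lowDegree 9))) (branch 0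
        5 (lemma 0 0x10123456789a) (branch 0 6 (lemma 1 0x10123456789a) (lowDegree 0)))) (branch 0 5
        (lemma 0 0x10123456789a) (branch 0 6 (lemma 1 0x10123456789a) (lowDegree 0)))) (lowDegree
        0)))) ∷
    stage (
      (0x1010512233445566778 , branch 2 8 (lowDegree 0) (lowDegree 8)) ∷
      []) (branch 0 4 (branch 4 8 (branch 0 3 (cut 0x111110222222) (lowDegree 0)) (lowDegree 8))
        (branch 0 5 (lemma 0 0x10123456789a) (branch 0 6 (branch 3 8 (lemma 0 0x18765432109a)
        (lowDegree 8)) (lowDegree 0)))) ∷
    stage (
      (0x1010203122334455667 , branch 3 7 (branch 4 6 (cut 0x111102202333) (lowDegree 4)) (lowDegree 7)) ∷
      (0x1010204122334455667 , branch 2 7 (lowDegree 3) (lowDegree 7)) ∷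
      (0x10102122334455667 , branch 0 3 (lemma 1 0x10123456789a) (branch 0 4 (lemma 0 0x10123456789a)
        (branch 0 5 (branch 0 6 (lowDegree 7) (branch 0 3 (lemma 1 0x10123456789a) (branch 0 4 (lemma
        0 0x10123456789a) (lowDegree 0)))) (lowDegree 0)))) ∷
      (0x10103122334455667 , branch 4 7 (branch 0 2 (lemma 0 0x10123456789a) (branch 5 7 (lemma 0
        0x17654321089a) (cut 0x110200304555))) (branch 5 7 (lemma 0 0x17654321089a) (lowDegree 7))) ∷
      []) (branch 0 2 (lemma 1 0x10123456789a) (branch 0 3 (lemma 0 0x10123456789a) (branch 0 4
        (branch 4 7 (lemma 0 0x17654321089a) (branch 5 7 (lemma 1 0x17654321089a) (lowDegree 7)))
        (lowDegree 0)))) ∷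
    stage (
      (0x101061223344556 , lowDegree 7) ∷
      (0x101021623344556 , lowDegree 7) ∷
      (0x101021223344556 , branch 1 6 (lemma 0 0x10123456789a) (branch 2 6 (branch 3 6 (cut
        0x111011112222) (branch 0 6 (lemma 1 0x10123456789a) (branch 1 6 (lemma 0 0x10123456789a)
        (lowDegree 6)))) (branch 0 6 (lemma 1 0x10123456789a) (lowDegree 6)))) ∷
      []) (branch 0 6 (lemma 2 0x10123456789a) (branch 0 2 (lemma 0 0x10123456789a) (branch 0 3
        (branch 2 6 (lowDegree 7) (branch 0 6 (lemma 2 0x10123456789a) (branch 4 6 (lemma 0
        0x16543210789a) (lowDegree 6)))) (lowDegree 0)))) ∷
    stage (
      (0x1010512233445 , cut 0x101111122222) ∷
      []) (branch 0 5 (lemma 0 0x10123456789a) (branch 0 2 (branch 1 5 (cut 0x101111122222) (branch 0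
        5 (lemma 0 0x10123456789a) (lowDegree 5))) (lowDegree 0))) ∷
    stage [] (branch 0 4 (cut 0x101111222222) (lowDegree 0)) ∷ shortPaths 4)

certificate12 : Refutation
certificate12 = refutation
  (
    stage (
      (0x101070a0b1223343a3b4556676b78898b9a , branch 2 6 (cut 0x1011022030445) (branch 2 8 (cut
        0x1011022030445) (lowDegree 2))) ∷
      (0x1010a0b1223343b4556676b78898b9a , branch 0 7 (branch 3 10 (lemma 0 0x10123456789ab) (branch 6
        10 (branch 3 7 (branch 4 6 (cut 0x1011022030445) (branch 0 4 (lemma 0 0x13210a987654b)
        (lowDegree 4))) (lowDegree 7)) (lowDegree 10))) (lowDegree 7)) ∷
      (0x1010a0b1223343b4556676b78899a , branch 8 11 (lemma 0 0x10123456789ab) (branch 9 11 (lemma 0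
        0x13456789a012b) (lowDegree 11))) ∷
      (0x1010a0b121a23343b45565b67787b899a , lowDegree 4) ∷
      (0x1010a0b122328343b45565b67787b899a , lowDegree 1) ∷
      (0x1010a0b1223343b45565b67787b899a , branch 1 10 (lemma 1 0x10123456789ab) (branch 2 8 (lemma 0
        0x10123456789ab) (branch 8 10 (branch 2 8 (lemma 0 0x10123456789ab) (branch 1 10 (lemma 1
        0x10123456789ab) (cut 0x1011020304445))) (cut 0x1011020304056)))) ∷
      (0x1010a0b1223343b455667787b899a , branch 5 11 (lemma 0 0x10123456789ab) (branch 9 11 (lemma 0
        0x13210a987654b) (lowDegree 11))) ∷
      (0x1010a0b1223343b4548565b6778899a , branch 8 11 (lemma 4 0x10a987654321b) (lowDegree 11)) ∷
      (0x101040a1223343b4547565b6778899a9b , cut 0x1011020304056) ∷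
      (0x101040a0b1223343b45565b6778899a , branch 4 7 (branch 9 11 (lemma 0 0x10123456789ab) (branch 7
        11 (lemma 2 0x10123456789ab) (lowDegree 11))) (branch 4 9 (branch 7 10 (cut 0x1011020304056)
        (branch 3 10 (branch 6 8 (cut 0x1011020333045) (cut 0x1011020304056)) (lowDegree 10))) (branch
        4 8 (lemma 1 0x10123456789ab) (lowDegree 4)))) ∷
      (0x1010a0b1223343b45566778899a , branch 6 11 (lemma 7 0x10123456789ab) (branch 7 11 (lemma 3
        0x10123456789ab) (branch 8 11 (lemma 7 0x13210a987654b) (branch 5 11 (branch 4 8 (lemma 2
        0x10123456789ab) (branch 0 4 (lemma 0 0x10123456789ab) (branch 4 7 (branch 4 9 (cut
        0x1011020304056) (branch 0 4 (lemma 0 0x10123456789ab) (lowDegree 4))) (lowDegree 4))))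
        (lowDegree 11))))) ∷
      (0x101050a0b1218232534454b56676b78899a , cut 0x1010203040556) ∷
      (0x101050a0b1219232534454b56676b78899a , cut 0x1010203044056) ∷
      (0x1050a0b121623253438454b566778899a , cut 0x1010203040556) ∷
      (0x101050a0b122334454b56676b78899a , branch 2 5 (branch 1 8 (lemma 2 0x10123456789ab) (branch 1
        9 (lemma 1 0x10123456789ab) (branch 1 4 (branch 1 6 (branch 3 8 (lemma 0 0x10123456789ab)
        (branch 3 9 (branch 2 11 (lemma 0 0x16543210a987b) (branch 9 11 (lemma 3 0x16789a012345b)
        (lowDegree 11))) (branch 5 8 (branch 2 11 (lemma 1 0x16543210a987b) (branch 8 11 (lemma 3
        0x10a987654321b) (lowDegree 11))) (branch 1 8 (lemma 2 0x10123456789ab) (branch 1 9 (lemma 1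
        0x10123456789ab) (branch 5 9 (lemma 5 0x19876543210ab) (branch 8 11 (lemma 3 0x10a987654321b)
        (branch 9 11 (lemma 3 0x16789a012345b) (cut 0x1010203044445))))))))) (branch 1 8 (lemma 2
        0x10123456789ab) (branch 1 9 (lemma 1 0x10123456789ab) (lowDegree 1)))) (lowDegree 1))))
        (branch 5 8 (branch 2 11 (cut 0x1010203040556) (branch 8 11 (lemma 3 0x10a987654321b)
        (lowDegree 11))) (branch 5 9 (branch 2 11 (cut 0x1010203044056) (branch 9 11 (lemma 3
        0x16789a012345b) (lowDegree 11))) (lowDegree 5)))) ∷
      (0x1010a0b12232534454b56676b78899a , branch 5 8 (cut 0x1010203040556) (branch 0 5 (lemma 0
        0x10123456789ab) (branch 5 9 (lemma 6 0x19876543210ab) (lowDegree 5)))) ∷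
      (0x1010a0b122334454b56676b78899a , branch 0 5 (lemma 1 0x10123456789ab) (branch 2 5 (lemma 0
        0x10123456789ab) (branch 5 8 (branch 0 5 (lemma 1 0x10123456789ab) (branch 2 5 (lemma 0
        0x10123456789ab) (lowDegree 5))) (lowDegree 5)))) ∷
      (0x1010a0b122334454b566778899a , branch 6 11 (lemma 0 0x10123456789ab) (branch 9 11 (lemma 0
        0x143210a98765b) (branch 7 11 (lemma 6 0x1456789a0123b) (branch 8 11 (lemma 6 0x10a987654321b)
        (lowDegree 11))))) ∷
      (0x1010a0b12233445565b6778899a , branch 2 11 (lemma 7 0x123456789a01b) (branch 3 11 (lemma 7
        0x10123456789ab) (branch 7 11 (lemma 0 0x10a987654321b) (branch 8 11 (lemma 7 0x10a987654321b)
        (branch 9 11 (lemma 0 0x156789a01234b) (lowDegree 11)))))) ∷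
      (0x1010a0b12233445566778899a , branch 3 11 (lemma 8 0x10123456789ab) (branch 4 11 (lemma 1
        0x10123456789ab) (branch 5 11 (lemma 0 0x10123456789ab) (branch 6 11 (lemma 0 0x10a987654321b)
        (branch 7 11 (lemma 1 0x10a987654321b) (branch 8 11 (lemma 8 0x10a987654321b) (lowDegree
        11))))))) ∷
      []) (branch 0 11 (lemma 0 0x10123456789ab) (branch 1 11 (lemma 0 0x1123456789a0b) (branch 2 11
        (lemma 0 0x123456789a01b) (branch 3 11 (lemma 0 0x13456789a012b) (branch 4 11 (lemma 0
        0x1456789a0123b) (branch 5 11 (lemma 0 0x156789a01234b) (branch 6 11 (lemma 0 0x16789a012345b)
        (branch 7 11 (lemma 0 0x1789a0123456b) (lowDegree 11))))))))) ∷
    stage (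
      (0x101090a1223343a4556676a7889ab , branch 0 11 (branch 1 6 (cut 0x1011022033344) (lowDegree 1))
        (lowDegree 11)) ∷
      (0x101090a1223343a4556676a787b898a , lowDegree 11) ∷
      (0x101090a1223343a4556676a7889 , branch 10 11 (lemma 1 0x10123456789ab) (branch 8 10 (branch 7
        11 (lemma 0 0x10123456789ab) (branch 0 7 (branch 3 7 (branch 3 9 (branch 1 5 (lowDegree 2)
        (branch 4 11 (lowDegree 11) (branch 5 11 (lowDegree 11) (branch 7 11 (lemma 0 0x10123456789ab)
        (branch 9 11 (lemma 0 0x16543210987ab) (branch 10 11 (lemma 1 0x10123456789ab) (cut
        0x1055011020345))))))) (branch 9 11 (lemma 0 0x16543210987ab) (lowDegree 9))) (branch 7 11
        (lemma 0 0x10123456789ab) (lowDegree 7))) (lowDegree 7))) (lowDegree 10))) ∷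
      (0x101090a1223343a45565a677889ab , lowDegree 11) ∷
      (0x101090a1223343a4556677889ab , branch 5 10 (lemma 0 0x10123456789ab) (branch 8 10 (lemma 0
        0x13210987654ab) (branch 6 10 (lemma 1 0x10123456789ab) (branch 7 10 (lemma 1 0x13210987654ab)
        (lowDegree 10))))) ∷
      (0x101090a1223343a4547565a677889 , branch 7 10 (lemma 2 0x13210987654ab) (branch 10 11 (lemma 0
        0x10123456789ab) (lowDegree 10))) ∷
      (0x101090a1223343a454b565a677889 , lowDegree 11) ∷
      (0x101090a1223393a4548565a676b7889 , lowDegree 11) ∷
      (0x101090a1223343a4556677889 , branch 6 10 (lemma 5 0x10123456789ab) (branch 7 10 (lemma 5
        0x13210987654ab) (branch 10 11 (lemma 3 0x10123456789ab) (branch 5 10 (branch 4 7 (lemma 2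
        0x10123456789ab) (branch 4 11 (lemma 1 0x10123456789ab) (branch 0 4 (branch 4 8 (branch 8 10
        (branch 3 9 (branch 6 11 (lemma 0 0x10123456789ab) (branch 7 11 (branch 5 9 (lemma 0
        0x13210987654ab) (lowDegree 9)) (branch 4 11 (lemma 1 0x10123456789ab) (branch 9 11 (lemma 1
        0x13210987654ab) (branch 10 11 (lemma 3 0x10123456789ab) (cut 0x1055010220345)))))) (branch 9
        11 (lemma 1 0x13210987654ab) (lowDegree 9))) (branch 10 11 (lemma 3 0x10123456789ab)
        (lowDegree 10))) (branch 4 7 (lemma 2 0x10123456789ab) (branch 4 11 (lemma 1 0x10123456789ab)
        (lowDegree 4)))) (lowDegree 4)))) (lowDegree 10))))) ∷
      (0x101090a122334454a56677889ab , branch 0 11 (branch 7 11 (lemma 0 0x10987654321ba) (lowDegree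
        11)) (lowDegree 11)) ∷
      (0x101090a1217232a34454a56677889 , branch 7 10 (lemma 1 0x10987654321ab) (branch 10 11 (lemma 0
        0x10123456789ab) (lowDegree 10))) ∷
      (0x101090a121b232a34454a56677889 , lowDegree 11) ∷
      (0x101090a12232a34454a565b677889 , branch 8 10 (branch 8 11 (lemma 3 0x15678901234ba) (lowDegree
        11)) (branch 6 10 (lemma 0 0x16543210987ab) (branch 7 10 (lemma 3 0x10987654321ab) (lowDegree
        10)))) ∷
      (0x101090a12232a34454a56677889 , branch 5 9 (branch 1 7 (lemma 2 0x10123456789ab) (branch 1 11
        (lemma 1 0x10123456789ab) (lowDegree 1))) (branch 5 11 (lemma 0 0x10123456789ab) (branch 7 9
        (branch 1 6 (branch 1 11 (lemma 1 0x10123456789ab) (branch 3 11 (lemma 1 0x14321098765ab)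
        (branch 5 11 (lemma 0 0x10123456789ab) (branch 10 11 (lemma 3 0x10123456789ab) (cut
        0x1010203055545))))) (branch 1 7 (lemma 2 0x10123456789ab) (branch 1 11 (lemma 1
        0x10123456789ab) (lowDegree 1)))) (branch 7 11 (branch 6 10 (lemma 0 0x12345678901ab) (branch
        7 10 (lemma 4 0x10987654321ab) (branch 8 10 (lemma 0 0x12109876543ab) (branch 10 11 (lemma 3
        0x10123456789ab) (lowDegree 10))))) (branch 9 11 (lemma 0 0x14321098765ab) (branch 1 7 (lemma
        2 0x10123456789ab) (branch 3 7 (lemma 2 0x14321098765ab) (branch 7 10 (lemma 4
        0x10987654321ab) (branch 1 11 (lemma 1 0x10123456789ab) (branch 3 11 (lemma 1 0x14321098765ab)
        (branch 10 11 (lemma 3 0x10123456789ab) (cut 0x1010203030456)))))))))))) ∷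
      (0x101090a122334454a56677889 , branch 10 11 (lemma 4 0x10123456789ab) (branch 2 10 (lemma 0
        0x10123456789ab) (branch 6 10 (branch 2 10 (lemma 0 0x10123456789ab) (branch 8 10 (lemma 0
        0x10987654321ab) (branch 10 11 (lemma 4 0x10123456789ab) (lowDegree 10)))) (branch 7 10 (lemma
        5 0x10987654321ab) (lowDegree 10))))) ∷
      (0x101090a12233445565a677889 , branch 2 10 (lemma 6 0x12345678901ab) (branch 3 10 (lemma 6
        0x10123456789ab) (branch 7 10 (lemma 6 0x10987654321ab) (branch 8 10 (lemma 6 0x15678901234ab)
        (lowDegree 10))))) ∷
      (0x101090a1223344556677889 , branch 2 10 (branch 4 10 (lemma 1 0x10123456789ab) (branch 5 10
        (lemma 7 0x12345678901ab) (branch 6 10 (lemma 1 0x10987654321ab) (branch 7 10 (lemma 7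
        0x10987654321ab) (branch 8 10 (lemma 1 0x12109876543ab) (lowDegree 10)))))) (branch 3 10
        (lemma 7 0x10123456789ab) (branch 4 10 (lemma 1 0x10123456789ab) (branch 5 10 (lemma 0
        0x10123456789ab) (branch 6 10 (lemma 1 0x10987654321ab) (branch 7 10 (lemma 7 0x10987654321ab)
        (lowDegree 10))))))) ∷
      []) (branch 0 10 (lemma 0 0x10123456789ab) (branch 1 10 (lemma 0 0x11234567890ab) (branch 2 10
        (lemma 0 0x12345678901ab) (branch 3 10 (lemma 0 0x13456789012ab) (branch 4 10 (lemma 0
        0x14567890123ab) (branch 5 10 (lemma 0 0x15678901234ab) (branch 6 10 (lemma 0 0x16789012345ab)
        (branch 7 10 (lemma 0 0x17890123456ab) (lowDegree 10))))))))) ∷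
    stage (
      (0x101080912233439455667789aab , lowDegree 11) ∷
      (0x10108090a121b23343a45566769789a , lowDegree 11) ∷
      (0x10108091223343945566769789a , branch 10 11 (lemma 1 0x10123456789ab) (branch 0 10 (branch 3
        10 (branch 6 10 (branch 1 11 (lemma 0 0x10123456789ab) (branch 2 11 (lemma 0 0x13210876549ab)
        (branch 4 11 (lemma 0 0x13456780129ab) (branch 5 11 (lemma 0 0x16543210879ab) (branch 7 11
        (lemma 0 0x16780123459ab) (branch 8 11 (lemma 0 0x10876543219ab) (branch 9 11 (lemma 1
        0x1012345678a9b) (branch 10 11 (lemma 1 0x10123456789ab) (lowDegree 11))))))))) (branch 10 11
        (lemma 1 0x10123456789ab) (lowDegree 10))) (branch 10 11 (lemma 1 0x10123456789ab) (lowDegree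
        10))) (lowDegree 10))) ∷
      (0x1010809122334394556676978 , branch 9 10 (lemma 0 0x10123456789ab) (branch 9 11 (lemma 0
        0x10123456789ba) (lowDegree 9))) ∷
      (0x101080912233439455667789a , branch 0 10 (branch 3 10 (branch 6 9 (lemma 0 0x10123456789ab)
        (branch 9 11 (lemma 3 0x1012345678a9b) (lowDegree 9))) (branch 10 11 (lemma 3 0x10123456789ab)
        (lowDegree 10))) (branch 10 11 (lemma 3 0x10123456789ab) (lowDegree 10))) ∷
      (0x101080912233439454a56596778 , lowDegree 10) ∷
      (0x10108091223383945475659676a7879 , lowDegree 10) ∷
      (0x10108091223343945566778 , branch 6 9 (lemma 3 0x10123456789ab) (branch 9 10 (lemma 2
        0x10123456789ab) (branch 9 11 (lemma 2 0x10123456789ba) (branch 5 9 (branch 4 7 (branch 7 9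
        (branch 3 8 (branch 6 10 (lemma 0 0x10123456789ab) (branch 6 11 (lemma 0 0x10123456789ba)
        (branch 4 10 (lemma 1 0x10123456789ab) (branch 4 11 (lemma 1 0x10123456789ba) (branch 8 10
        (lemma 1 0x13210876549ab) (branch 8 11 (lemma 1 0x13210876549ba) (branch 9 10 (lemma 2
        0x10123456789ab) (branch 9 11 (lemma 2 0x10123456789ba) (cut 0x1055010203455))))))))) (branch
        8 10 (lemma 1 0x13210876549ab) (branch 8 11 (lemma 1 0x13210876549ba) (lowDegree 8)))) (branch
        9 10 (lemma 2 0x10123456789ab) (branch 9 11 (lemma 2 0x10123456789ba) (lowDegree 9)))) (branch
        4 10 (lemma 1 0x10123456789ab) (branch 4 11 (lemma 1 0x10123456789ba) (lowDegree 4))))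
        (lowDegree 9))))) ∷
      (0x101080912233445495667789a , branch 0 10 (branch 9 11 (branch 10 11 (cut 0x1011102222333)
        (lowDegree 10)) (branch 6 9 (lemma 0 0x10876543219ab) (lowDegree 9))) (lowDegree 10)) ∷
      (0x10108091223344549566778 , branch 9 10 (lemma 0 0x10123456789ab) (branch 9 11 (lemma 0
        0x10123456789ba) (branch 6 9 (lemma 1 0x10876543219ab) (branch 7 9 (lemma 1 0x14567801239ab)
        (lowDegree 9))))) ∷
      (0x101080912232934455667789a , branch 5 10 (lowDegree 10) (lowDegree 10)) ∷
      (0x1010809122334455667789a , branch 2 9 (lemma 0 0x10123456789ab) (branch 7 9 (lemma 0
        0x10876543219ab) (branch 3 9 (lemma 3 0x10123456789ab) (branch 4 9 (lemma 1 0x10123456789ab)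
        (branch 5 9 (lemma 1 0x10876543219ab) (branch 6 9 (lemma 3 0x10876543219ab) (lowDegree
        9))))))) ∷
      (0x101080912233445566778 , branch 3 9 (lemma 4 0x10123456789ab) (branch 4 9 (lemma 2
        0x10123456789ab) (branch 5 9 (lemma 2 0x10876543219ab) (branch 6 9 (lemma 4 0x10876543219ab)
        (branch 9 10 (lemma 0 0x10123456789ab) (branch 9 11 (lemma 0 0x10123456789ba) (lowDegree
        9))))))) ∷
      []) (branch 0 9 (lemma 0 0x10123456789ab) (branch 1 9 (lemma 0 0x11234567809ab) (branch 2 9
        (lemma 0 0x12345678019ab) (branch 3 9 (lemma 0 0x13456780129ab) (branch 4 9 (lemma 0
        0x14567801239ab) (branch 5 9 (lemma 0 0x15678012349ab) (branch 6 9 (lemma 0 0x16780123459ab)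
        (branch 7 9 (lemma 0 0x17801234569ab) (lowDegree 9))))))))) ∷
    stage (
      (0x101070812233438455667899a , lowDegree 10) ∷
      (0x10107081223343845566789 , branch 9 10 (lemma 0 0x10123456789ab) (branch 9 11 (lemma 0
        0x10123456789ba) (lowDegree 9))) ∷
      (0x101070812233438455667 , branch 8 9 (lemma 0 0x10123456789ab) (branch 8 10 (lemma 0
        0x1012345678a9b) (branch 8 11 (lemma 0 0x1012345678b9a) (branch 5 8 (branch 8 9 (lemma 0
        0x10123456789ab) (branch 8 10 (lemma 0 0x1012345678a9b) (branch 8 11 (lemma 0 0x1012345678b9a)
        (lowDegree 8)))) (lowDegree 8))))) ∷
      (0x101070912233445485667898aab , lowDegree 11) ∷
      (0x10107090a121b2334454956678a9a , branch 4 11 (lemma 1 0x112345670b89a) (lowDegree 11)) ∷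
      (0x10107080912233445485667898a , branch 10 11 (lemma 1 0x10123456789ab) (branch 0 10 (branch 4 9
        (branch 9 10 (branch 1 11 (lemma 0 0x10123456789ab) (branch 1 3 (branch 0 11 (branch 3 11
        (lemma 2 0x101234567b89a) (branch 5 11 (lemma 2 0x107654321b89a) (lowDegree 11))) (branch 1 11
        (lemma 0 0x10123456789ab) (branch 3 11 (lemma 0 0x143210765a89b) (branch 5 11 (lemma 0
        0x145670123a89b) (branch 7 11 (lemma 0 0x10765432189ab) (branch 8 11 (lemma 1 0x1012345679a8b)
        (branch 9 11 (lemma 1 0x1012345678a9b) (branch 10 11 (lemma 1 0x10123456789ab) (lowDegree
        11))))))))) (lowDegree 1))) (branch 9 11 (lemma 1 0x1012345678a9b) (lowDegree 9))) (branch 9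
        11 (lemma 1 0x1012345678a9b) (lowDegree 9))) (lowDegree 10))) ∷
      (0x1010708091223344548566789 , branch 8 10 (lemma 0 0x10123456789ab) (branch 8 11 (lemma 0
        0x10123456789ba) (lowDegree 8))) ∷
      (0x10107081223344548566789 , branch 0 9 (lemma 0 0x10123456789ab) (branch 4 9 (lemma 0
        0x14567012389ab) (lowDegree 9))) ∷
      (0x1010708121923283445485667 , lowDegree 9) ∷
      (0x101070812233445485667 , branch 8 9 (lemma 1 0x10123456789ab) (branch 8 10 (lemma 1
        0x1012345678a9b) (branch 8 11 (lemma 1 0x1012345678b9a) (branch 2 8 (branch 6 8 (branch 1 9
        (lemma 0 0x10123456789ab) (branch 3 9 (lemma 0 0x12345670189ab) (branch 1 10 (lemma 0
        0x1012345678a9b) (branch 3 10 (lemma 0 0x1234567018a9b) (branch 1 11 (lemma 0 0x1012345678b9a)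
        (branch 3 11 (lemma 0 0x1234567018b9a) (branch 5 9 (lemma 0 0x14567012389ab) (branch 5 10
        (lemma 0 0x1456701238a9b) (branch 5 11 (lemma 0 0x1456701238b9a) (branch 7 9 (lemma 0
        0x10765432189ab) (branch 7 10 (lemma 0 0x1076543218a9b) (branch 7 11 (lemma 0 0x1076543218b9a)
        (branch 8 9 (lemma 1 0x10123456789ab) (branch 8 10 (lemma 1 0x1012345678a9b) (branch 8 11
        (lemma 1 0x1012345678b9a) (cut 0x1010102034555)))))))))))))))) (branch 8 9 (lemma 1
        0x10123456789ab) (branch 8 10 (lemma 1 0x1012345678a9b) (branch 8 11 (lemma 1 0x1012345678b9a)
        (lowDegree 8))))) (lowDegree 8))))) ∷
      (0x10107081223283445566789 , branch 9 10 (lowDegree 10) (lowDegree 9)) ∷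
      (0x101070812233439455667898a , branch 0 9 (lemma 8 0x10123456798ab) (branch 5 9 (lemma 0
        0x13456701298ab) (lowDegree 9))) ∷
      (0x101070809122334455667898a , branch 9 11 (branch 3 8 (lemma 9 0x10123456789ab) (branch 4 8
        (lemma 2 0x10123456789ab) (branch 5 8 (lemma 9 0x10765432189ab) (branch 3 9 (lemma 9
        0x10123456798ab) (branch 4 9 (lemma 2 0x10123456798ab) (branch 5 9 (lemma 9 0x10765432198ab)
        (branch 4 10 (lemma 8 0x1456701238a9b) (branch 4 11 (lemma 8 0x1456701239b8a) (cut
        0x1011111112222))))))))) (branch 3 9 (lemma 9 0x10123456798ab) (branch 4 9 (lemma 2
        0x10123456798ab) (branch 5 9 (lemma 9 0x10765432198ab) (lowDegree 9))))) ∷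
      (0x101070812233445566789 , branch 2 8 (lemma 2 0x10123456789ab) (branch 6 8 (lemma 2
        0x10765432189ab) (branch 8 10 (branch 3 9 (lemma 1 0x10123456789ab) (branch 5 9 (lemma 1
        0x10765432189ab) (branch 0 9 (lemma 0 0x10123456789ab) (branch 4 9 (branch 0 10 (lemma 0
        0x1012345678a9b) (branch 10 11 (lemma 9 0x14567012389ab) (lowDegree 10))) (lowDegree 9)))))
        (branch 3 8 (lemma 10 0x10123456789ab) (branch 4 8 (lemma 3 0x10123456789ab) (branch 5 8
        (lemma 10 0x10765432189ab) (lowDegree 8))))))) ∷
      (0x1010708122334455667 , branch 3 8 (lemma 11 0x10123456789ab) (branch 4 8 (lemma 4
        0x10123456789ab) (branch 5 8 (lemma 11 0x10765432189ab) (branch 8 9 (lemma 0 0x10123456789ab)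
        (branch 8 10 (lemma 0 0x1012345678a9b) (branch 8 11 (lemma 0 0x1012345678b9a) (lowDegree
        8))))))) ∷
      []) (branch 0 8 (lemma 0 0x10123456789ab) (branch 1 8 (lemma 0 0x11234567089ab) (branch 2 8
        (lemma 0 0x12345670189ab) (branch 3 8 (lemma 0 0x13456701289ab) (branch 4 8 (lemma 0
        0x14567012389ab) (branch 5 8 (lemma 0 0x15670123489ab) (branch 6 8 (lemma 0 0x16701234589ab)
        (branch 7 8 (lemma 0 0x17012345689ab) (lowDegree 8))))))))) ∷ [])
  (
    stage (
      (0x101061223344556676a78899aab , cut 0x1111111022222) ∷
      (0x1010612233445566768787a899aab , cut 0x1111111022222) ∷
      (0x1010612233445566778899aab , branch 6 10 (lemma 1 0x10123456789ab) (branch 7 10 (branch 6 8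
        (lemma 0 0x10123456789ab) (branch 8 11 (branch 6 9 (cut 0x1111111022222) (branch 6 11 (cut
        0x1111111022222) (branch 6 8 (lemma 0 0x10123456789ab) (branch 6 10 (lemma 1 0x10123456789ab)
        (cut 0x1111111102222))))) (lowDegree 8))) (lowDegree 10))) ∷
      (0x1010204121623344556676b787b899a , cut 0x1111111022222) ∷
      (0x102041226344556676b787b899aab , cut 0x1111111022222) ∷
      (0x10103042334364556676b787b899aab , cut 0x1111111022222) ∷
      (0x101041234454956676b787b899aab , lowDegree 8) ∷
      (0x101041234454656676b787b899aab , branch 5 9 (lowDegree 5) (branch 4 9 (lemma 0
        0x10123456789ab) (cut 0x1111111022222))) ∷
      (0x1010203041223344556676b787b899aab , branch 1 6 (lemma 4 0x10123456789ab) (branch 2 6 (lemma 3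
        0x10123456789ab) (branch 3 6 (lemma 2 0x10123456789ab) (branch 4 9 (lemma 1 0x10123456789ab)
        (branch 4 6 (lemma 0 0x10123456789ab) (branch 0 6 (lemma 5 0x10123456789ab) (cut
        0x1111110222222))))))) ∷
      (0x10103042334455657676b78898b9aab , cut 0x1111110222222) ∷
      (0x10104123445565a676b7879898b9aab , cut 0x1111110222222) ∷
      (0x1010203041223344556676b78899aab , branch 7 11 (lemma 2 0x10123456789ab) (branch 8 11 (branch
        5 7 (lemma 1 0x10123456789ab) (branch 7 9 (branch 7 10 (branch 5 8 (cut 0x1111110222222)
        (branch 5 9 (cut 0x1111110222222) (branch 5 10 (lemma 0 0x10123456789ab) (branch 5 7 (lemma 1
        0x10123456789ab) (branch 5 11 (lemma 8 0x1ba9876543210) (cut 0x1111111022222)))))) (branch 5 7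
        (lemma 1 0x10123456789ab) (branch 7 11 (lemma 2 0x10123456789ab) (lowDegree 7)))) (branch 7 11
        (lemma 2 0x10123456789ab) (lowDegree 7)))) (branch 5 11 (lemma 8 0x1ba9876543210) (lowDegree
        11)))) ∷
      (0x1031323243445565867787b898b9aab , branch 4 7 (lowDegree 6) (cut 0x1111110222222)) ∷
      (0x1031323243445565767687b898b9aab , cut 0x1111110222222) ∷
      (0x1041424344556596768787b898b9aab , cut 0x1111110222222) ∷
      (0x10414243445565a6768787b898b9aab , cut 0x1111110222222) ∷
      (0x101030412131423243445566768787b898b9aab , branch 5 7 (lemma 2 0x10123456789ab) (branch 5 9
        (lemma 1 0x10123456789ab) (branch 5 10 (lemma 0 0x10123456789ab) (branch 5 8 (lemma 3
        0x10123456789ab) (branch 5 11 (lemma 13 0x1ba9876543210) (cut 0x1111111022222)))))) ∷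
      (0x1041424344556596769787b8a8b9aab , cut 0x1111110222222) ∷
      (0x101020304121423243445565967787b898a8b9aab , branch 6 9 (lemma 0 0x10123456789ab) (branch 6 8
        (lemma 3 0x10123456789ab) (branch 6 11 (lemma 6 0x10123456789ab) (lowDegree 6)))) ∷
      (0x1041424344556576769787b898a9aab , cut 0x1111110222222) ∷
      (0x10414243445565a6769787b898b9aab , cut 0x1111110222222) ∷
      (0x101030412131423243445566769787b898a8b9aab , branch 5 7 (lemma 1 0x10123456789ab) (branch 5 10
        (lemma 0 0x10123456789ab) (branch 5 8 (lemma 8 0x10123456789ab) (branch 5 9 (lemma 3
        0x10123456789ab) (branch 5 11 (lemma 18 0x1ba9876543210) (cut 0x1111111022222)))))) ∷
      (0x101041214243445565a6778797b898b9aab , branch 6 8 (lemma 6 0x10123456789ab) (branch 6 9 (lemma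
        1 0x10123456789ab) (branch 6 11 (lemma 11 0x10123456789ab) (lowDegree 6)))) ∷
      (0x1010203041316232545566778899aab , cut 0x1111111022222) ∷
      (0x101030412142326455667787b899a , branch 4 7 (lowDegree 5) (cut 0x1111111022222)) ∷
      (0x1010203041213142334455667787b898b9aab , branch 2 4 (branch 5 8 (lemma 12 0x10123456789ab)
        (branch 6 8 (lemma 8 0x10123456789ab) (branch 8 10 (branch 5 9 (lemma 6 0x10123456789ab)
        (branch 6 9 (lemma 3 0x10123456789ab) (branch 7 9 (branch 5 10 (lemma 2 0x10123456789ab)
        (branch 6 10 (branch 5 7 (branch 6 8 (lemma 11 0x10123456789ab) (branch 6 9 (lemma 5
        0x10123456789ab) (branch 6 11 (lemma 15 0x10123456789ab) (lowDegree 6)))) (branch 5 8 (lemma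
        12 0x10123456789ab) (branch 5 9 (lemma 6 0x10123456789ab) (branch 5 10 (lemma 2
        0x10123456789ab) (branch 5 11 (lemma 22 0x1ba9876543210) (cut 0x1111111022222)))))) (branch 5
        8 (lemma 12 0x10123456789ab) (branch 6 8 (lemma 8 0x10123456789ab) (branch 5 9 (lemma 6
        0x10123456789ab) (branch 6 9 (lemma 3 0x10123456789ab) (branch 5 11 (lemma 22 0x1ba9876543210)
        (branch 6 11 (lemma 13 0x10123456789ab) (cut 0x1111111102222))))))))) (lowDegree 9))))
        (lowDegree 8)))) (branch 2 5 (branch 1 6 (lemma 1 0x10123456789ab) (branch 2 6 (cut
        0x1111111022222) (branch 3 6 (cut 0x1111111022222) (branch 4 6 (cut 0x1111111022222) (branch 0
        6 (lemma 22 0x10123456789ab) (cut 0x1111110222222)))))) (branch 2 6 (lemma 0 0x10123456789ab)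
        (lowDegree 2)))) ∷
      (0x1010304121315232645566778899aab , cut 0x1111111022222) ∷
      (0x1010304121516233445566778899aab , cut 0x1111111022222) ∷
      (0x1020304121523343645566778899aab , cut 0x1111111022222) ∷
      (0x1010304121523344546566778899aab , cut 0x1111111022222) ∷
      (0x101020304121315233445566778899aab , branch 1 6 (lemma 2 0x10123456789ab) (branch 3 6 (lemma 1
        0x10123456789ab) (branch 4 6 (lemma 0 0x10123456789ab) (branch 0 6 (lemma 27 0x10123456789ab)
        (branch 2 6 (lemma 3 0x10123456789ab) (cut 0x1111110222222)))))) ∷
      (0x10102030412132334455667787b898b9aab , branch 1 4 (lemma 5 0x10123456789ab) (branch 1 5 (lemma
        0 0x10123456789ab) (branch 1 6 (branch 0 5 (branch 1 4 (lemma 5 0x10123456789ab) (branch 2 4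
        (lemma 20 0x1ba9876543210) (branch 4 6 (lemma 21 0x1ba9876543210) (lowDegree 4)))) (branch 1 5
        (lemma 3 0x10123456789ab) (branch 2 5 (lemma 7 0x10123456789ab) (lowDegree 5)))) (lowDegree
        1)))) ∷
      (0x1010203041214152334455667787b899aab , branch 0 6 (lemma 29 0x10123456789ab) (branch 1 6
        (lemma 4 0x10123456789ab) (branch 2 6 (lemma 7 0x10123456789ab) (branch 3 6 (lemma 3
        0x10123456789ab) (branch 4 6 (lemma 2 0x10123456789ab) (cut 0x1111110222222)))))) ∷
      (0x101030412141623455667787b899a , branch 4 7 (lowDegree 5) (cut 0x1111111022222)) ∷
      (0x10102030412233445566778899aab , branch 6 11 (lemma 22 0x10123456789ab) (branch 7 11 (branch 8
        11 (branch 1 3 (lemma 2 0x10123456789ab) (branch 1 4 (branch 1 5 (lemma 1 0x10123456789ab)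
        (branch 1 6 (lemma 0 0x10123456789ab) (branch 1 3 (lemma 2 0x10123456789ab) (lowDegree 1))))
        (branch 1 5 (branch 1 3 (lemma 3 0x10123456789ab) (branch 1 4 (lemma 1 0x10123456789ab)
        (branch 1 6 (lemma 6 0x10123456789ab) (lowDegree 1)))) (lowDegree 1)))) (branch 5 11 (lemma 31
        0x1ba9876543210) (branch 6 11 (lemma 22 0x10123456789ab) (lowDegree 11)))) (branch 5 11 (lemma
        31 0x1ba9876543210) (lowDegree 11)))) ∷
      (0x1010203051223344546566778899aab , cut 0x1111111022222) ∷
      (0x101020312233445566778899aab , branch 0 4 (lemma 1 0x10123456789ab) (branch 0 5 (branch 4 6
        (lemma 0 0x10123456789ab) (branch 1 4 (branch 1 6 (cut 0x1111111022222) (branch 2 6 (cut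
        0x1111111022222) (branch 3 6 (cut 0x1111111022222) (branch 0 6 (lemma 33 0x10123456789ab)
        (branch 4 6 (lemma 0 0x10123456789ab) (cut 0x1111110222222)))))) (branch 0 4 (lemma 1
        0x10123456789ab) (lowDegree 4)))) (branch 0 6 (lemma 33 0x10123456789ab) (lowDegree 0)))) ∷
      (0x101020412132334354556676b787b899aab , branch 3 6 (cut 0x1111111022222) (branch 0 6 (lemma 34
        0x10123456789ab) (branch 1 6 (lemma 33 0x10123456789ab) (branch 2 6 (lemma 32 0x10123456789ab)
        (branch 4 6 (lemma 29 0x10123456789ab) (cut 0x1111110222222)))))) ∷
      (0x101020412132334354556676b78899aab , branch 7 11 (lemma 0 0x10123456789ab) (branch 8 11
        (branch 5 11 (lemma 35 0x1ba9876543210) (branch 7 11 (lemma 0 0x10123456789ab) (branch 9 11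
        (lemma 1 0x1ba9876543210) (lowDegree 11)))) (branch 5 11 (lemma 35 0x1ba9876543210) (lowDegree
        11)))) ∷
      (0x10102041213233445566778899aab , branch 3 5 (branch 8 11 (branch 5 11 (lemma 36
        0x1ba9876543210) (branch 6 11 (lemma 0 0x10123456789ab) (branch 9 11 (lemma 2 0x1ba9876543210)
        (lowDegree 11)))) (branch 5 11 (lemma 36 0x1ba9876543210) (branch 6 11 (lemma 0
        0x10123456789ab) (lowDegree 11)))) (branch 3 6 (branch 0 5 (cut 0x1111111022222) (branch 0 3
        (lemma 2 0x10123456789ab) (branch 0 6 (lemma 36 0x10123456789ab) (lowDegree 0)))) (branch 0 3
        (lemma 2 0x10123456789ab) (lowDegree 3)))) ∷
      (0x1010212233445566778899aab , branch 0 3 (lemma 3 0x10123456789ab) (branch 0 4 (branch 1 3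
        (lemma 0 0x10123456789ab) (branch 3 5 (branch 3 6 (cut 0x1111111022222) (branch 0 3 (lemma 3
        0x10123456789ab) (branch 1 3 (lemma 0 0x10123456789ab) (lowDegree 3)))) (branch 0 3 (lemma 3
        0x10123456789ab) (lowDegree 3)))) (branch 0 6 (lemma 37 0x10123456789ab) (lowDegree 0)))) ∷
      []) (branch 0 6 (lemma 38 0x10123456789ab) (branch 0 2 (lemma 0 0x10123456789ab) (branch 0 3
        (branch 0 4 (branch 0 5 (branch 6 11 (branch 7 11 (branch 1 6 (branch 1 4 (lemma 7
        0x10123456789ab) (branch 2 4 (lemma 30 0x1ba9876543210) (branch 4 6 (lemma 33 0x10123456789ab)
        (lowDegree 4)))) (branch 2 6 (cut 0x1111111022222) (branch 0 6 (lemma 38 0x10123456789ab)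
        (branch 3 6 (lemma 35 0x10123456789ab) (branch 4 6 (lemma 33 0x10123456789ab) (cut
        0x1111110222222)))))) (branch 5 11 (lemma 38 0x1ba9876543210) (branch 9 11 (lemma 0
        0x1ba9876543210) (lowDegree 11)))) (branch 5 11 (lemma 38 0x1ba9876543210) (branch 9 11 (lemma
        0 0x1ba9876543210) (lowDegree 11)))) (branch 0 2 (lemma 0 0x10123456789ab) (branch 0 6 (lemma
        38 0x10123456789ab) (lowDegree 0)))) (branch 0 2 (lemma 0 0x10123456789ab) (branch 0 6 (lemma
        38 0x10123456789ab) (lowDegree 0)))) (lowDegree 0)))) ∷
    stage (
      (0x1010612233445566778899a , branch 6 10 (branch 7 10 (cut 0x1222222011112) (lowDegree 7))
        (lowDegree 10)) ∷
      (0x10102030512233445565a6778899a , branch 3 11 (lowDegree 11) (cut 0x1111110222222)) ∷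
      (0x10102030512233445566778899a , branch 5 10 (lemma 0 0x10123456789ab) (branch 6 10 (branch 7 10
        (lowDegree 11) (branch 5 10 (lemma 0 0x10123456789ab) (lowDegree 10))) (lowDegree 10))) ∷
      (0x1010204051213233445565a6778899a , cut 0x1111110222222) ∷
      (0x101020512233445566778899a , branch 0 3 (lemma 1 0x10123456789ab) (branch 0 4 (branch 3 6 (cut
        0x1111111022222) (branch 1 3 (branch 5 10 (lemma 0 0x10123456789ab) (branch 6 10 (branch 7 10
        (lowDegree 11) (branch 5 10 (lemma 0 0x10123456789ab) (lowDegree 10))) (lowDegree 10)))
        (branch 0 3 (lemma 1 0x10123456789ab) (lowDegree 3)))) (branch 0 6 (lemma 3 0x10123456789ab)
        (lowDegree 0)))) ∷
      (0x1010304051223243445565a6778899a , cut 0x1111110222222) ∷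
      (0x1010512233445566778899a , branch 0 2 (lemma 1 0x10123456789ab) (branch 0 3 (branch 2 6 (cut
        0x1111111022222) (branch 2 4 (branch 0 4 (branch 5 10 (lemma 0 0x10123456789ab) (branch 6 10
        (branch 7 10 (lowDegree 11) (branch 5 10 (lemma 0 0x10123456789ab) (lowDegree 10))) (lowDegree
        10))) (branch 0 2 (lemma 1 0x10123456789ab) (branch 0 6 (lemma 5 0x10123456789ab) (lowDegree
        0)))) (branch 0 2 (lemma 1 0x10123456789ab) (lowDegree 2)))) (branch 0 6 (lemma 5
        0x10123456789ab) (lowDegree 0)))) ∷
      []) (branch 0 6 (lemma 6 0x10123456789ab) (branch 0 5 (lemma 0 0x10123456789ab) (branch 0 2
        (branch 0 3 (branch 0 4 (branch 6 10 (branch 7 10 (lowDegree 11) (branch 4 10 (lemma 6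
        0x1a9876543210b) (branch 5 10 (lemma 0 0x1a9876543210b) (lowDegree 10)))) (branch 4 10 (lemma
        6 0x1a9876543210b) (branch 5 10 (lemma 0 0x1a9876543210b) (lowDegree 10)))) (branch 0 5 (lemma
        0 0x10123456789ab) (branch 0 6 (lemma 6 0x10123456789ab) (lowDegree 0)))) (branch 0 5 (lemma 0
        0x10123456789ab) (branch 0 6 (lemma 6 0x10123456789ab) (lowDegree 0)))) (lowDegree 0)))) ∷
    stage (
      (0x101061223344556677889 , lowDegree 9) ∷
      (0x101051223344556677889 , branch 5 9 (branch 6 9 (cut 0x1222220111122) (lowDegree 6)) (lowDegree 9)) ∷
      []) (branch 0 6 (lemma 1 0x10123456789ab) (branch 0 5 (lemma 0 0x10123456789ab) (branch 0 4
        (branch 0 2 (branch 0 3 (branch 5 9 (branch 6 9 (lowDegree 10) (branch 4 9 (lemma 0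
        0x19876543210ab) (lowDegree 9))) (branch 4 9 (lemma 0 0x19876543210ab) (lowDegree 9))) (branch
        0 5 (lemma 0 0x10123456789ab) (branch 0 6 (lemma 1 0x10123456789ab) (lowDegree 0)))) (branch 0
        5 (lemma 0 0x10123456789ab) (branch 0 6 (lemma 1 0x10123456789ab) (lowDegree 0)))) (lowDegree
        0)))) ∷
    stage (
      (0x1010512233445566778 , branch 2 8 (lowDegree 0) (lowDegree 8)) ∷
      []) (branch 0 4 (branch 4 8 (branch 0 3 (cut 0x1111102222222) (lowDegree 0)) (lowDegree 8))
        (branch 0 5 (lemma 0 0x10123456789ab) (branch 0 6 (branch 3 8 (lemma 0 0x18765432109ab)
        (lowDegree 8)) (lowDegree 0)))) ∷
    stage (
      (0x1010203122334455667 , branch 3 7 (branch 4 6 (cut 0x1111022023333) (lowDegree 4)) (lowDegree 7)) ∷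
      (0x1010204122334455667 , branch 2 7 (lowDegree 3) (lowDegree 7)) ∷
      (0x10102122334455667 , branch 0 3 (lemma 1 0x10123456789ab) (branch 0 4 (lemma 0
        0x10123456789ab) (branch 0 5 (branch 0 6 (lowDegree 7) (branch 0 3 (lemma 1 0x10123456789ab)
        (branch 0 4 (lemma 0 0x10123456789ab) (lowDegree 0)))) (lowDegree 0)))) ∷
      (0x10103122334455667 , branch 4 7 (branch 0 2 (lemma 0 0x10123456789ab) (branch 5 7 (lemma 0
        0x17654321089ab) (cut 0x1102003045555))) (branch 5 7 (lemma 0 0x17654321089ab) (lowDegree 7)))
        ∷
      []) (branch 0 2 (lemma 1 0x10123456789ab) (branch 0 3 (lemma 0 0x10123456789ab) (branch 0 4
        (branch 4 7 (lemma 0 0x17654321089ab) (branch 5 7 (lemma 1 0x17654321089ab) (lowDegree 7)))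
        (lowDegree 0)))) ∷
    stage (
      (0x101061223344556 , cut 0x1011111122222) ∷
      (0x101021623344556 , cut 0x1011111122222) ∷
      (0x101021223344556 , branch 1 6 (lemma 0 0x10123456789ab) (branch 2 6 (branch 3 6 (cut
        0x1110111122222) (branch 0 6 (lemma 1 0x10123456789ab) (branch 1 6 (lemma 0 0x10123456789ab)
        (lowDegree 6)))) (branch 0 6 (lemma 1 0x10123456789ab) (lowDegree 6)))) ∷
      []) (branch 0 6 (lemma 2 0x10123456789ab) (branch 0 2 (lemma 0 0x10123456789ab) (branch 0 3
        (branch 2 6 (cut 0x1011111122222) (branch 0 6 (lemma 2 0x10123456789ab) (branch 4 6 (lemma 0
        0x16543210789ab) (lowDegree 6)))) (lowDegree 0)))) ∷
    stage (
      (0x1010512233445 , cut 0x1011111222222) ∷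
      []) (branch 0 5 (lemma 0 0x10123456789ab) (branch 0 2 (branch 1 5 (cut 0x1011111222222) (branch
        0 5 (lemma 0 0x10123456789ab) (lowDegree 5))) (lowDegree 0))) ∷
    stage [] (branch 0 4 (cut 0x1011112222222) (lowDegree 0)) ∷ shortPaths 4)

-- The lower bound

certificates : List Refutation
certificates =
  certificate4 ∷ certificate5 ∷ certificate6 ∷ certificate7 ∷ certificate8 ∷
  certificate9 ∷ certificate10 ∷ certificate11 ∷ certificate12 ∷ []

checkRefutations : ℕ → List Refutation → Bool
checkRefutations n []       = true
checkRefutations n (r ∷ rs) = checkRefutation n r ∧ checkRefutations (suc n) rs

checkRefutations-sound : ∀ n rs → T (checkRefutations n rs) → ∀ {m} → n ≤ m → m < n + length rs →
  ∃ λ r → T (checkRefutation m r)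
checkRefutations-sound n [] t n≤m m<n = contradiction (≤-trans m<n (≤-trans (≤-reflexive (+-identityʳ n)) n≤m)) (<-irrefl refl)
checkRefutations-sound n (r ∷ rs) t {m} n≤m m<n with ∧-proj {checkRefutation n r} t | m≤n⇒m<n∨m≡n n≤m
... | t₁ , _  | inj₂ refl = r , t₁
... | _  , t₂ | inj₁ n<m  = checkRefutations-sound (suc n) rs t₂ n<m (subst (m <_) (+-suc n (length rs)) m<n)

other : n ≢ 1 → (v : Fin n) → ∃ λ w → v ≢ w
other {suc zero}    n≢1 zero    = contradiction refl n≢1
other {suc (suc _)} n≢1 zero    = suc zero , λ ()
other {suc (suc _)} n≢1 (suc _) = zero , λ ()

module _ {n : ℕ} (G : Graph n) where

  -- A walk to any other vertex leaves `v` by an edge.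
  degree-positive : Connected G → n ≢ 1 → ∀ v → 0 < degree G v
  degree-positive (_ , walk) n≢1 v with other n≢1 v
  ... | w , v≢w with walk v w
  ...   | here              = contradiction refl v≢w
  ...   | step {w = u} vu _ = ∈-length (∈-filter⁺ _ (∈-allFin u) (Equivalence.from T-≡ vu))

  degree≥4 : Connected G → n ≢ 1 → (∀ v → 2 ∣ degree G v) → BarnacleFree G → ∀ v → 4 ≤ degree G v
  degree≥4 connected n≢1 even free v with even v
  ... | divides 0 eq             = contradiction (subst (0 <_) eq (degree-positive connected n≢1 v)) (<-irrefl refl)
  ... | divides 1 eq             = contradiction eq (free v)
  ... | divides (suc (suc q)) eq = subst (4 ≤_) (≡-sym eq) (s≤s (s≤s (s≤s (s≤s z≤n))))

  degree≤n : ∀ v → degree G v ≤ n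
  degree≤n v = ≤-trans (length-filter _ (allFin n)) (≤-reflexive (length-tabulate id))

  lower-bound : Harris G → BarnacleFree G → 13 ≤ n
  lower-bound ((connected@(v , _) , cuts) , (_ , even) , nonhamiltonian) free with 13 ≤? n
  ... | yes 13≤n = 13≤n
  ... | no 13≰n  =
    -- The underscore stands for the evaluation of all certificates. There are nine of them,
    -- starting at order 4, so they cover every order below 13.
    let r , t = checkRefutations-sound 4 certificates _ 4≤n (≰⇒> 13≰n)
    in contradiction t (Soundness.refute G minDegree cuts (nonhamiltonian ∘ inj₂) (≤-trans (n≤1+n 3) 4≤n) r)
    where
    minDegree : ∀ v → 4 ≤ degree G v
    -- The convention that the one-vertex graph is Hamiltonian enters here, as `n ≢ 1`.
    minDegree = degree≥4 connected (nonhamiltonian ∘ inj₁) even free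
    4≤n : 4 ≤ n
    -- The crude bound `degree≤n` yields 4 and not 5, which is why the certificates begin at order
    -- 4.
    4≤n = ≤-trans (minDegree v) (degree≤n v)

-- A barnacle-free Harris graph on 13 vertices

module _ {n : ℕ} (G : Graph n) where

  module _ (S : Subset n) where

    -- The list runs from the latest vertex to the earliest. A vertex outside S that has an earlier
    -- neighbour outside S shares its component, so the roots meet every component of G − S.
    roots : List (Fin n × List (Fin n)) → List (Fin n)
    roots []                = []
    roots ((v , ws) ∷ rest) =
      if lookup S v ∨ any (not ∘ lookup S) ws then roots rest else v ∷ roots rest

    -- A vertex keeps all its candidates for a parent, because it depends on `S` which of them
    -- survive.
    Forest : List (Fin n × List (Fin n)) → Set
    Forest []                = ⊤
    Forest ((v , ws) ∷ rest) = All (λ w → Adj G v w × w ∈ map proj₁ rest) ws × Forest rest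

    lookup-∉ : ∀ {v} → T (not (lookup S v)) → v ∉ S
    lookup-∉ t v∈ = subst (T ∘ not) ([]=⇒lookup v∈) t

    -- Moving to an earlier neighbour outside `S` shortens the list, so the walk ends, and it can
    -- only end at a root.
    walk-to-root : ∀ order → Forest order → ∀ {v} → v ∈ map proj₁ order → v ∉ S →
      ∃ λ r → r ∈ roots order × WalkAvoiding G S v r
    walk-to-root ((v , ws) ∷ rest) (edges , forest) v∈ v∉
      with lookup S v in inS | any (not ∘ lookup S) ws in hangs | v∈
    ... | true  | _     | here refl = contradiction (lookup⇒[]= v S inS) v∉
    ... | true  | _     | there v∈′ = walk-to-root rest forest v∈′ v∉
    ... | false | true  | there v∈′ = walk-to-root rest forest v∈′ v∉
    ... | false | false | here refl = v , here refl , here v∉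
    ... | false | false | there v∈′ with walk-to-root rest forest v∈′ v∉
    ...   | r , r∈ , walk = r , there r∈ , walk
    walk-to-root ((v , ws) ∷ rest) (edges , forest) v∈ v∉ | false | true | here refl
      with All.lookupAny edges (any⁻ (not ∘ lookup S) ws (Equivalence.from T-≡ hangs))
    ... | (vw , w∈) , w∉ with walk-to-root rest forest w∈ (lookup-∉ w∉)
    ...   | r , r∈ , walk = r , r∈ , step v∉ vw walk

    -- Assigning to each member of the family a root that it reaches is injective: two members with
    -- the same root would be joined through it.
    componentsAtMost-roots : ∀ order → Forest order → (∀ v → v ∈ map proj₁ order) →
      ComponentsAtMost G S (length (roots order))
    componentsAtMost-roots order forest covers xs xs∉ apart =
      subst (_≤ length (roots order)) (length-chosen xs∉) (length-mono-⊆ (distinct xs∉ apart) (chosen⊆ xs∉))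
      where
      root : ∀ {v} → v ∉ S → ∃ λ r → r ∈ roots order × WalkAvoiding G S v r
      root = walk-to-root order forest (covers _)
      chosen : ∀ {xs} → All (_∉ S) xs → List (Fin n)
      chosen = All.reduce (proj₁ ∘ root)
      length-chosen : ∀ {xs} (ps : All (_∉ S) xs) → length (chosen ps) ≡ length xs
      length-chosen []       = refl
      length-chosen (_ ∷ ps) = cong suc (length-chosen ps)
      chosen⊆ : ∀ {xs} (ps : All (_∉ S) xs) {r} → r ∈ chosen ps → r ∈ roots order
      chosen⊆ (p ∷ _)  (here refl) = proj₁ (proj₂ (root p))
      chosen⊆ (_ ∷ ps) (there r∈)  = chosen⊆ ps r∈
      fresh : ∀ {x xs} (p : x ∉ S) (ps : All (_∉ S) xs) → All (λ y → ¬ WalkAvoiding G S x y) xs →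
        All (proj₁ (root p) ≢_) (chosen ps)
      fresh p []       []       = []
      fresh p (q ∷ ps) (¬w ∷ ws) =
        (λ eq → ¬w (walk-trans G (proj₂ (proj₂ (root p)))
                  (walk-sym G (subst (WalkAvoiding G S _) (≡-sym eq) (proj₂ (proj₂ (root q)))))))
        ∷ fresh p ps ws
      distinct : ∀ {xs} (ps : All (_∉ S) xs) → AllPairs (λ u v → ¬ WalkAvoiding G S u v) xs → Unique (chosen ps)
      distinct []       []       = []
      distinct (p ∷ ps) (w ∷ ws) = fresh p ps w ∷ distinct ps ws

  earlierNeighbours : List (Fin n) → List (Fin n × List (Fin n))
  earlierNeighbours []       = []
  earlierNeighbours (v ∷ vs) = (v , filterᵇ (adj G v) vs) ∷ earlierNeighbours vs

  map-earlierNeighbours : ∀ vs → map proj₁ (earlierNeighbours vs) ≡ vs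
  map-earlierNeighbours []       = refl
  map-earlierNeighbours (v ∷ vs) = cong (v ∷_) (map-earlierNeighbours vs)

  forest : ∀ S vs → Forest S (earlierNeighbours vs)
  forest S []       = _
  forest S (v ∷ vs) = All.tabulate edge , forest S vs
    where
    edge : ∀ {w} → w ∈ filterᵇ (adj G v) vs → Adj G v w × w ∈ map proj₁ (earlierNeighbours vs)
    edge w∈ with ∈-filter⁻ _ {xs = vs} w∈
    ... | w∈vs , vw = Equivalence.to T-≡ vw , subst (_ ∈_) (≡-sym (map-earlierNeighbours vs)) w∈vs

  componentsAtMost-order : ∀ S vs → (∀ v → v ∈ vs) → ComponentsAtMost G S (length (roots S (earlierNeighbours vs)))
  componentsAtMost-order S vs covers = componentsAtMost-roots S (earlierNeighbours vs) (forest S vs)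
    (λ v → subst (v ∈_) (≡-sym (map-earlierNeighbours vs)) (covers v))

-- Toughness and connectedness by evaluation

allSubsets : ∀ n → (Subset n → Bool) → Bool
allSubsets zero    p = p []
allSubsets (suc n) p = allSubsets n (p ∘ (inside ∷_)) ∧ allSubsets n (p ∘ (outside ∷_))

allSubsets-sound : ∀ n {p} → T (allSubsets n p) → ∀ S → T (p S)
allSubsets-sound zero    t []            = t
allSubsets-sound (suc n) {p} t (true ∷ S)  = allSubsets-sound n (proj₁ (∧-proj {allSubsets n (p ∘ (inside ∷_))} t)) S
allSubsets-sound (suc n) {p} t (false ∷ S) = allSubsets-sound n (proj₂ (∧-proj {allSubsets n (p ∘ (inside ∷_))} t)) S

module _ {n : ℕ} (G : Graph n) where

  fewRoots : Subset n → List (Fin n × List (Fin n)) → Bool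
  fewRoots S order = length (roots G S order) ≤ᵇ ∣ S ∣

  -- Roots can outnumber components, since one component may contain several vertices without an
  -- earlier neighbour outside `S`. The second order is a fallback for the sets where the first one
  -- overcounts.
  toughOrders : List (Fin n) → List (Fin n) → Bool
  toughOrders vs ws = decide (earlierNeighbours G vs) (earlierNeighbours G ws)
    where
    -- A separate function, so that evaluation computes the neighbour lists only once.
    decide : List (Fin n × List (Fin n)) → List (Fin n × List (Fin n)) → Bool
    decide order order′ = allSubsets n λ S → (∣ S ∣ ≡ᵇ 0) ∨ fewRoots S order ∨ fewRoots S order′

  toughOrders-sound : ∀ vs ws → (∀ v → v ∈ vs) → (∀ v → v ∈ ws) → T (toughOrders vs ws) →
    ∀ S → Nonempty S → ComponentsAtMost G S ∣ S ∣
  toughOrders-sound vs ws ∈vs ∈ws t S (v , v∈S) xs xs∉ apart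
    with ∨-case {∣ S ∣ ≡ᵇ 0} (allSubsets-sound n t S)
  ... | inj₁ t′ = contradiction (subst (∣ S Subset.- v ∣ <_) (≡ᵇ⇒≡ _ 0 t′) (x∈p⇒∣p-x∣<∣p∣ v∈S)) λ ()
  ... | inj₂ t′ with ∨-case {fewRoots S (earlierNeighbours G vs)} t′
  ...   | inj₁ t″ = ≤-trans (componentsAtMost-order G S vs ∈vs xs xs∉ apart) (≤ᵇ⇒≤ _ _ t″)
  ...   | inj₂ t″ = ≤-trans (componentsAtMost-order G S ws ∈ws xs xs∉ apart) (≤ᵇ⇒≤ _ _ t″)

  -- With nothing removed every vertex walks to a root, and a single root joins any two vertices.
  connected : ∀ r vs → (∀ v → v ∈ vs) → roots G ∅ (earlierNeighbours G vs) ≡ r ∷ [] → Connected G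
  connected r vs ∈vs single = r , λ u v → forget G (walk-trans G (to-r u) (walk-sym G (to-r v)))
    where
    to-r : ∀ v → WalkAvoiding G ∅ v r
    to-r v with walk-to-root G ∅ (earlierNeighbours G vs) (forest G ∅ vs)
                  (subst (v ∈_) (≡-sym (map-earlierNeighbours G vs)) (∈vs v)) ∉⊥
    ... | s , s∈ , walk with subst (s ∈_) single s∈
    ...   | here refl = walk

  -- Spanning cycles: rotation and exhaustive search

  linked-split : ∀ xs {m ys} → Linked (Adj G) (xs ++ m ∷ ys) → Linked (Adj G) (xs ++ [ m ]) × Linked (Adj G) (m ∷ ys)
  linked-split []           l       = [-] , l
  linked-split (x ∷ [])     (e ∷ l) = e ∷ [-] , l
  linked-split (x ∷ y ∷ xs) (e ∷ l) with linked-split (y ∷ xs) l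
  ... | l₁ , l₂ = e ∷ l₁ , l₂

  linked-join : ∀ xs {m ys} → Linked (Adj G) (xs ++ [ m ]) → Linked (Adj G) (m ∷ ys) → Linked (Adj G) (xs ++ m ∷ ys)
  linked-join []           _        l  = l
  linked-join (x ∷ [])     (e ∷ _)  l  = e ∷ l
  linked-join (x ∷ y ∷ xs) (e ∷ l₁) l₂ = e ∷ linked-join (y ∷ xs) l₁ l₂

-- A missing vertex put in front would make n + 1 distinct elements of `Fin n`.
unique⇒∈ : ∀ {n} {xs : List (Fin n)} → Unique xs → length xs ≡ n → ∀ v → v ∈ xs
unique⇒∈ {n} {xs} uniq len v with member? _≟ᶠ_ v xs
... | yes v∈ = v∈
... | no v∉  = contradiction (length-mono-⊆ (All.tabulate (λ x∈ → λ { refl → v∉ x∈ }) ∷ uniq) (λ {w} _ → ∈-allFin w))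
                 (<-irrefl refl ∘ subst (_≤ n) (cong suc len) ∘ λ le → ≤-trans le (≤-reflexive (length-tabulate _)))

-- The search starts at a fixed vertex, while a spanning cycle may be listed from anywhere; so the
-- cycle is cut at `s` and its two pieces are exchanged.
rotate : ∀ {n} (G : Graph n) s → SpanningCycle G →
  Σ (List (Fin n)) λ xs → (suc (length xs) ≡ n) × Unique (s ∷ xs) × Linked (Adj G) (s ∷ xs ++ [ s ])
rotate {n} G s (x , xs , _ , len , uniq , linked) with ∈-∃++ (unique⇒∈ uniq len s)
... | []     , bs , refl = bs , len , uniq , linked
... | a ∷ as , bs , refl = bs ++ a ∷ as , len′ , Unique-resp-↭ (++-comm (a ∷ as) (s ∷ bs)) uniq ,
  subst (Linked (Adj G) ∘ (s ∷_)) (≡-sym (++-assoc bs (a ∷ as) [ s ]))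
    (linked-join G (s ∷ bs) (proj₂ split) (proj₁ split))
  where
  open Permutation (setoid (Fin n)) using (Unique-resp-↭; ++-comm)
  split : Linked (Adj G) (a ∷ as ++ [ s ]) × Linked (Adj G) (s ∷ bs ++ [ a ])
  split = linked-split G (a ∷ as) (subst (Linked (Adj G) ∘ (a ∷_)) (++-assoc as (s ∷ bs) [ a ]) linked)
  len′ : suc (length (bs ++ a ∷ as)) ≡ n
  len′ = trans (length-++ (s ∷ bs)) (trans (+-comm (length (s ∷ bs)) (length (a ∷ as)))
    (trans (≡-sym (length-++ (a ∷ as))) len))

unvisited : ∀ {n} {x y : Fin n} → x ≢ y → ∀ visited → T (not (member (toℕ y) visited)) →
  T (not (member (toℕ y) (toℕ x ∷ visited)))
unvisited {x = x} {y} x≢y visited y∉ with toℕ x ≡ᵇ toℕ y in eq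
... | false = y∉
... | true  = contradiction (toℕ-injective (≡ᵇ⇒≡ _ _ (Equivalence.from T-≡ eq))) x≢y

module FromRows (n : ℕ) (rows : List (List ℕ)) where

  row : ℕ → List ℕ
  row = lookupOr [] rows

  adjacent : Fin n → Fin n → Bool
  adjacent u v = member (toℕ v) (row (toℕ u))

  -- The second argument counts the vertices still to be visited; at 0 the path must close up at
  -- `s`.
  hamiltonPath : ℕ → ℕ → ℕ → List ℕ → Bool
  hamiltonPath s zero    v visited = member s (row v)
  hamiltonPath s (suc k) v visited =
    any (λ w → not (member w visited) ∧ hamiltonPath s k w (w ∷ visited)) (row v)

  module _ (G : Graph n) (rows-adj : ∀ u v → adj G u v ≡ adjacent u v) where

    -- The search succeeds by following the given path: its vertices are distinct, so none of them
    -- has been visited when its turn comes.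
    hamiltonPath-complete : ∀ s v xs visited →
      Linked (Adj G) (v ∷ xs ++ [ s ]) → Unique xs → All (λ x → T (not (member (toℕ x) visited))) xs →
      T (hamiltonPath (toℕ s) (length xs) (toℕ v) visited)
    hamiltonPath-complete s v []       visited (vs ∷ _) _ _ = Equivalence.from T-≡ (trans (≡-sym (rows-adj v s)) vs)
    hamiltonPath-complete s v (x ∷ xs) visited (vx ∷ linked) (x≢ ∷ uniq) (new ∷ news) =
      any⁺ _ (Any.map next (any⁻ (_≡ᵇ toℕ x) (row (toℕ v)) (Equivalence.from T-≡ (trans (≡-sym (rows-adj v x)) vx))))
      where
      next : ∀ {w} → T (w ≡ᵇ toℕ x) → T (not (member w visited) ∧ hamiltonPath (toℕ s) (length xs) w (w ∷ visited))
      next {w} t with ≡ᵇ⇒≡ w _ t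
      ... | refl = Equivalence.from T-∧
        (new , hamiltonPath-complete s x xs (toℕ x ∷ visited) linked uniq (All.zipWith (λ (x≢y , ∉) → unvisited x≢y visited ∉) (x≢ , news)))

    nonhamiltonian : ∀ s → ¬ T (hamiltonPath (toℕ s) (pred n) (toℕ s) (toℕ s ∷ [])) → ¬ SpanningCycle G
    nonhamiltonian s none cycle with rotate G s cycle
    ... | xs , len , s≢ ∷ uniq , linked =
      none (subst (λ k → T (hamiltonPath (toℕ s) k (toℕ s) (toℕ s ∷ []))) (cong pred len)
        (hamiltonPath-complete s s xs (toℕ s ∷ []) linked uniq (All.map (λ s≢y → unvisited s≢y [] _) s≢)))

-- Vertices 0–3 form a set U; outside U there are the isolated vertices 4–6 and the triangle
-- 10 11 12 with the pendant vertices 7, 8, 9. A spanning cycle would need two edges to U at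
-- each of 4, 5, 6 and at least one at each of 7, 8, 9, but U can receive only eight.
graph13-rows : List (List ℕ)
graph13-rows =
  (4 ∷ 5 ∷ 6 ∷ 7 ∷ 8 ∷ 9 ∷ []) ∷
  (4 ∷ 5 ∷ 6 ∷ 8 ∷ 9 ∷ 10 ∷ []) ∷
  (4 ∷ 5 ∷ 6 ∷ 7 ∷ 9 ∷ 11 ∷ []) ∷
  (4 ∷ 5 ∷ 6 ∷ 7 ∷ 8 ∷ 12 ∷ []) ∷
  (0 ∷ 1 ∷ 2 ∷ 3 ∷ []) ∷
  (0 ∷ 1 ∷ 2 ∷ 3 ∷ []) ∷
  (0 ∷ 1 ∷ 2 ∷ 3 ∷ []) ∷
  (0 ∷ 2 ∷ 3 ∷ 10 ∷ []) ∷
  (0 ∷ 1 ∷ 3 ∷ 11 ∷ []) ∷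
  (0 ∷ 1 ∷ 2 ∷ 12 ∷ []) ∷
  (1 ∷ 7 ∷ 11 ∷ 12 ∷ []) ∷
  (2 ∷ 8 ∷ 10 ∷ 12 ∷ []) ∷
  (3 ∷ 9 ∷ 10 ∷ 11 ∷ []) ∷ []

open FromRows 13 graph13-rows

graph13 : Graph 13
graph13 = record
  { adj    = adjacent
  ; sym    = from-yes (all? λ u → all? λ v → adjacent u v Bool.≟ adjacent v u)
  ; irrefl = from-yes (all? λ u → adjacent u u Bool.≟ false)
  }

-- Found by search: for every nonempty S one of the two orders has at most |S| roots.
order order′ : List (Fin 13)
order  = # 6 ∷ # 4 ∷ # 9 ∷ # 3 ∷ # 2 ∷ # 12 ∷ # 5 ∷ # 11 ∷ # 7 ∷ # 0 ∷ # 10 ∷ # 8 ∷ # 1 ∷ []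
order′ = # 0 ∷ # 7 ∷ # 2 ∷ # 8 ∷ # 5 ∷ # 6 ∷ # 11 ∷ # 4 ∷ # 3 ∷ # 9 ∷ # 1 ∷ # 10 ∷ # 12 ∷ []

harris13 : Harris graph13 × BarnacleFree graph13
-- The final underscore evaluates `toughOrders` over all 2^13 subsets.
harris13 = ((conn , toughOrders-sound graph13 order order′ order-covers order′-covers _) ,
            (conn , from-yes (all? λ u → 2 ∣? degree graph13 u)) ,
            -- The absurd `λ ()` is accepted because the exhaustive search from vertex 4 evaluates
            -- to `false`.
            λ { (inj₂ cycle) → nonhamiltonian graph13 (λ _ _ → refl) (# 4) (λ ()) cycle }) ,
           from-yes (all? λ u → ¬? (degree graph13 u ≟ 2))
  where
  order-covers : ∀ v → v ∈ order
  order-covers = from-yes (all? λ v → member? _≟ᶠ_ v order)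
  order′-covers : ∀ v → v ∈ order′
  order′-covers = from-yes (all? λ v → member? _≟ᶠ_ v order′)
  conn : Connected graph13
  -- Vertex 1 is the last entry of `order`, hence the earliest vertex, and the only root when
  -- nothing is removed.
  conn = connected graph13 (# 1) order order-covers refl

theorem3 : (Σ (Graph 13) λ G → Harris G × BarnacleFree G)
    × (∀ (n : ℕ) (G : Graph n) → Harris G → BarnacleFree G → 13 ≤ n)
theorem3 = (graph13 , harris13) , λ _ → lower-bound
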